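{- Let $C\ge 1$ be a constant and let $A(1),A(2),\ldots$ be a sequence of non-negative integers satisfying, for all $n>C$, a linear recurrence $$A(n)=\sum_{i=1}^{C} D(n,i)\,A(n-i)$$ whose coefficients $D(n,i)$ are non-negative integers, of $\mathrm{poly}(n)$ size (that is, bounded by a polynomial in $n$), and such that $(1^n\,0\,1^i)\mapsto D(n,i)$ is in $\mathsf{FL}_{\ge0}$. Then the function $(1^n)\mapsto A(n)$ is in $\#\mathsf{L}$. Here $A(1),\ldots,A(C)$ are given constants.
   Context: The alphabet is $\Sigma=\{0,1\}$; $1^a$ is the string of $a$ ones and juxtaposition is concatenation. A function given only on strings of a displayed form is extended by $0$ to all other strings. $\#\mathsf{L}$ is the class of functions $f:\Sigma^*\to\mathbb{N}_0$ such that $f(x)$ is the number of accepting computation paths on input $x$ of a fixed nondeterministic Turing machine with read-only input tape that uses $O(\log|x|)$ work space and halts on every computation path. Equivalently: there are a polynomial $q$ and a deterministic $O(\log|x|)$-space Turing machine $M$ with an additional read-once, left-to-right witness tape such that $f(x)=\#\{w\in\Sigma^{q(|x|)}\mid M(x,w)=\mathsf{yes}\}$. $\mathsf{FL}_{\ge0}$ is the class of functions $\Sigma^*\to\mathbb{N}_0$ computable (output in binary) by a deterministic log-space Turing machine with read-only input tape and write-only output tape (not counted as space). -}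

module Defs where

open import Data.Bool.Base using (Bool; true; false; T; if_then_else_)
open import Data.Fin.Base using (Fin)
open import Data.List.Base
  using (List; []; _∷_; _++_; length; lookup; map; null; applyUpTo; fromMaybe; foldl)
open import Data.List.Membership.Propositional using (_∈_)
open import Data.Maybe.Base as Maybe using (Maybe; just; nothing)
open import Data.Nat.Base using (ℕ; zero; suc; pred; _+_; _*_; _⊓_; _≤_)
open import Data.Nat.ListAction using (sum)
open import Data.Nat.Logarithm using (⌊log₂_⌋)
open import Data.Product.Base using (_×_; _,_; ∃; ∃-syntax; Σ-syntax; map₁)
open import Data.Vec.Base as Vec using (Vec)
open import Function.Base using (_∘_; flip)
open import Function.Bundles using (_↔_)
open import Induction.WellFounded using (Acc)
open import Relation.Binary.Construct.Closure.ReflexiveTransitive using (Star)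
open import Relation.Binary.PropositionalEquality.Core using (_≡_)
open import Relation.Nullary.Decidable.Core using (Dec; does)

Finite : Set → Set
Finite S = ∃[ n ] (S ↔ Fin n)

-- Strings over Σ = {0,1}, with false = 0 and true = 1.
Word : Set
Word = List Bool

data Dir : Set where
  left stay right : Dir

-- The part of a two-way infinite work tape visited so far; before lists
-- the cells to the left of the head, nearest cell first.
record Tape (Γ : Set) : Set where
  constructor tape
  field
    before : List Γ
    cur    : Γ
    after  : List Γ

-- Visited cells are never dropped, so this is the number of distinct cells
-- that the head has scanned.
cells : ∀ {Γ} → Tape Γ → ℕ
cells (tape ls _ rs) = length ls + suc (length rs)

write : ∀ {Γ} → Γ → Tape Γ → Tape Γ
write a (tape ls _ rs) = tape ls a rs

move : ∀ {Γ} → Γ → Dir → Tape Γ → Tape Γ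
move blank left  (tape []       a rs)       = tape [] blank (a ∷ rs)
move blank left  (tape (l ∷ ls) a rs)       = tape ls l (a ∷ rs)
move blank stay  t                          = t
move blank right (tape ls       a [])       = tape (a ∷ ls) blank []
move blank right (tape ls       a (r ∷ rs)) = tape (a ∷ ls) r rs

data InputSymbol : Set where
  ⊢ ⊣ : InputSymbol
  bit : Bool → InputSymbol

-- The input tape carries ⊢ x ⊣; position 0 holds ⊢ and position 1 + |x| holds ⊣.
scan : Word → ℕ → InputSymbol
scan x       zero          = ⊢
scan []      (suc p)       = ⊣
scan (b ∷ x) (suc zero)    = bit b
scan (b ∷ x) (suc (suc p)) = scan x (suc p)

-- The input head cannot leave the positions 0, …, 1 + |x|.
moveInput : Word → Dir → ℕ → ℕ
moveInput x left  p = pred p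
moveInput x stay  p = p
moveInput x right p = suc p ⊓ suc (length x)

record Hardware : Set₁ where
  field
    State       : Set
    finiteState : Finite State
    start       : State
    Γ           : Set
    finiteΓ     : Finite Γ
    blank       : Γ
    tapes       : ℕ

  record Config : Set where
    eta-equality
    constructor config
    field
      state : State
      head  : ℕ
      work  : Vec (Tape Γ) tapes

  record Action : Set where
    eta-equality
    constructor action
    field
      next      : State
      inputMove : Dir
      writes    : Vec (Γ × Dir) tapes

  initial : Config
  initial = config start 0 (Vec.replicate tapes (tape [] blank []))

  space : Config → ℕ
  space (config _ _ ts) = Vec.sum (Vec.map cells ts)

  perform : Word → Config → Action → Config
  perform x (config _ p ts) (action q d ws) =
    config q (moveInput x d p)
      (Vec.zipWith (λ { (a , e) t → move blank e (write a t) }) ws ts)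

  view : ∀ {B : Set} → (State → InputSymbol → Vec Γ tapes → B) → Word → Config → B
  view δ x (config q p ts) = δ q (scan x p) (Vec.map Tape.cur ts)

  -- The 1 + covers |x| ≤ 1, where the logarithm vanishes.
  LogSpace : (Word → Config → Config → Set) → Set
  LogSpace _⟨_⟩⟶_ =
    ∃[ c ] ∀ x d → Star (_⟨_⟩⟶_ x) initial d → space d ≤ c * (1 + ⌊log₂ length x ⌋)

-- A computation halts when no transition is applicable and accepts when it
-- halts in an accepting state.
record NTM : Set₁ where
  field
    hardware : Hardware
  open Hardware hardware public
  field
    δ         : State → InputSymbol → Vec Γ tapes → List Action
    accepting : State → Bool

  successors : Word → Config → List Config
  successors x c = map (perform x c) (view δ x c)

  Step : Word → Config → Config → Set
  Step x c d = d ∈ successors x c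

  HaltsOnEveryPath : Word → Set
  HaltsOnEveryPath x = Acc (flip (Step x)) initial

  -- A step is the choice of a position in the list of transitions, so that
  -- computation paths are sequences of nondeterministic choices.
  data AcceptingPath (x : Word) (c : Config) : Set where
    halt : T (null (successors x c)) → T (accepting (Config.state c)) →
           AcceptingPath x c
    step : (i : Fin (length (successors x c))) →
           AcceptingPath x (lookup (successors x c) i) → AcceptingPath x c

#L : (Word → ℕ) → Set₁
#L f = Σ[ M ∈ NTM ] let open NTM M in
  LogSpace Step
  × (∀ x → HaltsOnEveryPath x)
  × (∀ x → AcceptingPath x initial ↔ Fin (f x))

-- Each step may append one bit to the write-only output tape.
record Transducer : Set₁ where
  field
    hardware : Hardware
  open Hardware hardware public
  field
    δ : State → InputSymbol → Vec Γ tapes → Maybe (Action × Maybe Bool)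

  next : Word → Config → Maybe (Config × Maybe Bool)
  next x c = Maybe.map (map₁ (perform x c)) (view δ x c)

  Step : Word → Config → Config → Set
  Step x c d = ∃[ b ] next x c ≡ just (d , b)

  -- Outputs x c w: started in c, the machine halts after writing exactly w.
  data Outputs (x : Word) (c : Config) : Word → Set where
    halt : next x c ≡ nothing → Outputs x c []
    step : ∀ {d b w} → next x c ≡ just (d , b) → Outputs x d w →
           Outputs x c (fromMaybe b ++ w)

-- Most significant bit first; leading zeros are harmless and [] denotes 0.
binary : Word → ℕ
binary = foldl (λ v b → 2 * v + (if b then 1 else 0)) 0

FL≥0 : (Word → ℕ) → Set₁
FL≥0 f = Σ[ M ∈ Transducer ] let open Transducer M in
  LogSpace Step
  × (∀ x → ∃[ w ] Outputs x initial w × binary w ≡ f x)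

-- 1ⁿ ↦ A n, and 0 on all other strings.
on1ⁿ : (ℕ → ℕ) → Word → ℕ
on1ⁿ A []          = A 0
on1ⁿ A (true  ∷ x) = on1ⁿ (A ∘ suc) x
on1ⁿ A (false ∷ x) = 0

-- 1ⁿ 0 1ⁱ ↦ D n i, and 0 on all other strings.
on1ⁿ01ⁱ : (ℕ → ℕ → ℕ) → Word → ℕ
on1ⁿ01ⁱ D []          = 0
on1ⁿ01ⁱ D (true  ∷ x) = on1ⁿ01ⁱ (D ∘ suc) x
on1ⁿ01ⁱ D (false ∷ x) = on1ⁿ (D 0) x

-- Restricts a family to its range of indices by setting it to 0 elsewhere.
_when_ : ∀ {P : Set} → ℕ → Dec P → ℕ
v when P? = if does P? then v else 0

-- f 1 + … + f m
∑₁ : ℕ → (ℕ → ℕ) → ℕ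
∑₁ m f = sum (applyUpTo (f ∘ suc) m)

{-# OPTIONS --safe #-}
module Submission where

-- Unfolding the recurrence writes A(n) as a sum of products of coefficients D, and a
-- nondeterministic machine can enumerate the terms. It holds a number m, initially n. While
-- m > C, it guesses i, splits into D(m,i) computation paths and replaces m by m - i; once m ≤ C,
-- it splits into A(m) accepting paths. Induction on m shows that A(m) paths accept. The point is
-- to do this in logarithmic space.
--
-- Splitting into D(m,i) paths. The machine runs the transducer for D on 1^m 0 1^i and consumes
-- the output bits, most significant first, as they appear, guessing at the same time the bits of
-- a word of the same length. It remembers only whether this guess is still equal to the output
-- or already below it, and dies as soon as the guess exceeds the output. The guesses that end
-- below the output are as many as the value of the output (weight-binary), so that nothing has
-- to be stored and neither leading zeros nor the magnitude of D(m,i) matter.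
--
-- Reading 1^m 0 1^i. This word is 1^k u with k = m - C - 1 and u = 1^(C+1) 0 1^i. As k ≤ n, the
-- positions 0, …, k are positions p of the real input head, and the positions in u are kept in
-- the finite state. A binary counter on a work tape of its own holds k - p; it changes along
-- with every move of the head, and it is zero exactly at the border to u. Returning the head to
-- position 0 restores k, and since m - i = k + (C + 1 - i), passing to m - i and testing whether
-- m - i ≤ C both amount to decrementing the counter up to i times.
--
-- Reusing the work tapes. The transducer runs up to n times, and each run needs blank tapes. A
-- cell records whether it has been written since the last reset, and the cell where the head
-- started carries a mark. A reset sweeps to the left end of the written region, erases rightwards,
-- and walks back to the mark (sweep-left, sweep-erase, sweep-seek). Starting every run on the
-- same cell keeps the visited cells within distance S of the mark, where S exceeds the space of
-- a run (sim-cells).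
--
-- Bookkeeping. A Run is a finite computation tree with its number of accepting leaves. Since the
-- number of visited cells never decreases, space has to be bounded only at the leaves
-- (#L-by-runs). The trees are built backwards, from the end of the computation to its beginning:
-- Good says that n paths accept from every machine configuration that represents a given
-- configuration of a program with a counter and a reset instruction. One instruction is treated
-- in issue-run, a run of the transducer in simulate-good, and the recurrence in loop-good.

open import Defs
open import Data.Bool.Base using (Bool; true; false; T; if_then_else_; _∧_)
open import Data.Bool.Properties using (T-irrelevant)
open import Data.Empty using (⊥; ⊥-elim)
open import Data.Fin.Base using (Fin; zero; suc; toℕ; inject₁; fromℕ)
open import Data.Fin.Patterns
open import Data.Fin.Properties
  using (1↔⊤; 2↔Bool; +↔⊎; *↔×; toℕ-inject₁; toℕ-fromℕ; toℕ<n; toℕ≤pred[n])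
open import Data.List.Base
  using (List; []; _∷_; _++_; length; lookup; map; null; replicate; allFin; foldl; fromMaybe;
         applyUpTo; tabulate)
open import Data.List.Membership.Propositional using (_∈_)
open import Data.List.Membership.Propositional.Properties using (∈-map⁻)
open import Data.List.Properties using (length-++; length-replicate; map-cong; map-tabulate)
open import Data.List.Relation.Binary.Pointwise using (Pointwise; []; _∷_)
open import Data.List.Relation.Unary.Any using (here; there)
open import Data.Maybe.Base using (Maybe; just; nothing)
open import Data.Nat.Base using (ℕ; zero; suc; _+_; _*_; _∸_; _⊓_; _^_; _≤_; _<_; z≤n; s≤s)
open import Data.Nat.Induction using (<-wellFounded)
open import Data.Nat.ListAction using (sum)
open import Data.Nat.Logarithm
open import Data.Nat.Properties
open import Data.Nat.Tactic.RingSolver using (solve-∀)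
open import Data.Product.Algebra using (×-cong)
open import Data.Product.Base using (_×_; _,_; ∃₂; ∃-syntax; Σ-syntax; proj₁; proj₂)
open import Data.Sum.Algebra using (⊎-cong)
open import Data.Sum.Base using (_⊎_; inj₁; inj₂)
open import Data.Unit.Base using (⊤; tt)
open import Data.Vec.Base as Vec using (Vec; []; _∷_)
open import Data.Vec.Relation.Binary.Pointwise.Inductive
  using ([]; _∷_) renaming (Pointwise to VPointwise)
open import Data.Vec.Relation.Unary.All as All using (All; []; _∷_)
open import Data.Vec.Relation.Unary.All.Properties using (map⁺)
open import Function.Base using (_∘_; flip)
open import Function.Bundles using (_↔_; mk↔ₛ′)
open import Function.Properties.Inverse using (↔-refl; ↔-sym; ↔-trans)
open import Induction.WellFounded using (Acc; acc)
open import Relation.Binary.Construct.Closure.ReflexiveTransitive using (Star; ε; _◅_; _◅◅_)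
open import Relation.Binary.PropositionalEquality
open import Relation.Nullary.Decidable using (Dec; yes; no; _×-dec_)

-- Finite sets

finite-⊎ : ∀ {A B} → Finite A → Finite B → Finite (A ⊎ B)
finite-⊎ (m , f) (n , g) = m + n , ↔-trans (⊎-cong f g) (↔-sym +↔⊎)

finite-× : ∀ {A B} → Finite A → Finite B → Finite (A × B)
finite-× (m , f) (n , g) = m * n , ↔-trans (×-cong f g) (↔-sym *↔×)

finite-⊤ : Finite ⊤
finite-⊤ = 1 , ↔-sym 1↔⊤

finite-Bool : Finite Bool
finite-Bool = 2 , ↔-sym 2↔Bool

finite-Fin : ∀ n → Finite (Fin n)
finite-Fin n = n , ↔-refl

finite-↔ : ∀ {A B} → A ↔ B → Finite B → Finite A
finite-↔ f (n , g) = n , ↔-trans f g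

-- Computation trees

cells-move : ∀ {Γ} (blank a : Γ) e t → cells t ≤ cells (move blank e (write a t))
cells-move blank a left  (tape []       _ rs)       = n≤1+n _
cells-move blank a left  (tape (l ∷ ls) _ rs)       =
  ≤-reflexive (sym (+-suc (length ls) (suc (length rs))))
cells-move blank a stay  (tape ls       _ rs)       = ≤-refl
cells-move blank a right (tape ls       _ [])       = n≤1+n _
cells-move blank a right (tape ls       _ (r ∷ rs)) =
  ≤-reflexive (+-suc (length ls) (suc (length rs)))

-- f is a free variable so that the anonymous function inside perform can be
-- replaced by any function that agrees with it.
sum-cells-zipWith : ∀ {Γ : Set} {n} (blank : Γ) {f : Γ × Dir → Tape Γ → Tape Γ} →
  (∀ w t → f w t ≡ move blank (proj₂ w) (write (proj₁ w) t)) →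
  (ws : Vec (Γ × Dir) n) (ts : Vec (Tape Γ) n) →
  Vec.sum (Vec.map cells ts) ≤ Vec.sum (Vec.map cells (Vec.zipWith f ws ts))
sum-cells-zipWith blank f≗ []             []       = z≤n
sum-cells-zipWith blank f≗ ((a , e) ∷ ws) (t ∷ ts) =
  +-mono-≤ (subst (λ u → cells t ≤ cells u) (sym (f≗ (a , e) t)) (cells-move blank a e t))
           (sum-cells-zipWith blank f≗ ws ts)

module Runs (M : NTM) where
  open NTM M

  -- Run x B c n: the computation tree of c on input x is finite, has n accepting paths, and all its
  -- leaves use space at most B. An accepting configuration must be a leaf; a rejecting leaf is a
  -- branch without subtrees.
  data Run (x : Word) (B : ℕ) (c : Config) : ℕ → Set where
    accept : successors x c ≡ [] → T (accepting (Config.state c)) → space c ≤ B → Run x B c 1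
    branch : ∀ {ns} → accepting (Config.state c) ≡ false →
             (successors x c ≡ [] → space c ≤ B) →
             Pointwise (Run x B) (successors x c) ns → Run x B c (sum ns)

  space-step : ∀ {x c d} → Step x c d → space c ≤ space d
  space-step {x} {config q p ts} d∈
    with ∈-map⁻ (perform x (config q p ts)) {xs = view δ x (config q p ts)} d∈
  ... | action _ _ ws , _ , refl = sum-cells-zipWith blank (λ _ _ → refl) ws ts

  -- A leaf below c bounds the space of c, because space grows along every path.
  run-space : ∀ {x B c n} → Run x B c n → space c ≤ B
  run-space (accept _ _ s) = s
  run-space {x} {c = c} (branch _ s rs) = go refl s rs
    where
    go : ∀ {ds ns B} → successors x c ≡ ds → (ds ≡ [] → space c ≤ B) →
         Pointwise (Run x B) ds ns → space c ≤ B
    go eq s []      = s refl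
    go {d ∷ _} eq _ (r ∷ _) =
      ≤-trans (space-step {c = c} {d} (subst (_ ∈_) (sym eq) (here refl))) (run-space r)

  run-Star : ∀ {x B c d n} → Run x B c n → Star (Step x) c d → space d ≤ B
  run-Star r ε = run-space r
  run-Star (accept eq _ _) (d∈ ◅ _) with () ← subst (_ ∈_) eq d∈
  run-Star {x} {B} {d = d} (branch _ _ rs) (_◅_ {j = e} d∈ ds) = go rs d∈
    where
    go : ∀ {cs ns} → Pointwise (Run x B) cs ns → e ∈ cs → space d ≤ B
    go (r ∷ _)  (here refl) = run-Star r ds
    go (_ ∷ rs) (there d∈)  = go rs d∈

  run-Acc : ∀ {x B c n} → Run x B c n → Acc (flip (Step x)) c
  run-Acc (accept eq _ _) = acc λ d∈ → ⊥-elim (∉[] (subst (_ ∈_) eq d∈))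
    where
    ∉[] : ∀ {A : Set} {y : A} → y ∈ [] → ⊥
    ∉[] ()
  run-Acc {x} {B} (branch _ _ rs) = acc (go rs)
    where
    go : ∀ {cs ns d} → Pointwise (Run x B) cs ns → d ∈ cs → Acc (flip (Step x)) d
    go (r ∷ _)  (here refl) = run-Acc r
    go (_ ∷ rs) (there d∈)  = go rs d∈

  -- The accepting paths from any of the configurations cs.
  Choice : Word → List Config → Set
  Choice x cs = Σ[ i ∈ Fin (length cs) ] AcceptingPath x (lookup cs i)

  choice-∷ : ∀ {x c cs} → Choice x (c ∷ cs) ↔ (AcceptingPath x c ⊎ Choice x cs)
  choice-∷ = mk↔ₛ′
    (λ { (zero , p) → inj₁ p ; (suc i , p) → inj₂ (i , p) })
    (λ { (inj₁ p) → zero , p ; (inj₂ (i , p)) → suc i , p })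
    (λ { (inj₁ _) → refl ; (inj₂ _) → refl })
    (λ { (zero , _) → refl ; (suc _ , _) → refl })

  accept-paths : ∀ {x c} → successors x c ≡ [] → T (accepting (Config.state c)) →
                 AcceptingPath x c ↔ ⊤
  accept-paths {x} {c} eq a = mk↔ₛ′ (λ _ → tt) (λ _ → halt stuck a) (λ _ → refl) unique
    where
    stuck : T (null (successors x c))
    stuck = subst (λ ds → T (null ds)) (sym eq) tt
    unique : (p : AcceptingPath x c) → halt stuck a ≡ p
    unique (halt s b) = cong₂ halt (T-irrelevant stuck s) (T-irrelevant a b)
    unique (step i _) with () ← subst (λ ds → Fin (length ds)) eq i

  branch-paths : ∀ {x c} → accepting (Config.state c) ≡ false →
                 AcceptingPath x c ↔ Choice x (successors x c)
  branch-paths {x} {c} rejecting = mk↔ₛ′ to (λ { (i , p) → step i p }) (λ _ → refl) from-to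
    where
    absurd : T (accepting (Config.state c)) → ⊥
    absurd = subst T rejecting
    to : AcceptingPath x c → Choice x (successors x c)
    to (halt _ a) = ⊥-elim (absurd a)
    to (step i p) = i , p
    from-to : ∀ p → step (proj₁ (to p)) (proj₂ (to p)) ≡ p
    from-to (halt _ a) = ⊥-elim (absurd a)
    from-to (step _ _) = refl

  run-paths : ∀ {x B c n} → Run x B c n → AcceptingPath x c ↔ Fin n
  run-paths (accept eq a _)        = ↔-trans (accept-paths eq a) (↔-sym 1↔⊤)
  run-paths {x} {B} (branch rej _ rs) = ↔-trans (branch-paths rej) (go rs)
    where
    go : ∀ {cs ns} → Pointwise (Run x B) cs ns → Choice x cs ↔ Fin (sum ns)
    go []       = mk↔ₛ′ (λ ()) (λ ()) (λ ()) (λ ())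
    go (r ∷ rs) = ↔-trans choice-∷ (↔-trans (⊎-cong (run-paths r) (go rs)) (↔-sym +↔⊎))

  #L-by-runs : ∀ {f} c → (∀ x → Run x (c * (1 + ⌊log₂ length x ⌋)) initial (f x)) → #L f
  #L-by-runs c r =
    M , (c , λ x d → run-Star (r x)) , (λ x → run-Acc (r x)) , λ x → run-paths (r x)

  -- A deterministic step.
  run-step : ∀ {x B c d n} → accepting (Config.state c) ≡ false →
             successors x c ≡ d ∷ [] → Run x B d n → Run x B c n
  run-step {x} {B} {c} {d} {n} rej eq r =
    subst (Run x B c) (+-identityʳ n)
      (branch rej (λ eq′ → ⊥-elim (∷≢[] (trans (sym eq) eq′)))
        (subst (λ ds → Pointwise (Run x B) ds (n ∷ [])) (sym eq) (r ∷ [])))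
    where
    ∷≢[] : d ∷ [] ≡ [] → ⊥
    ∷≢[] ()

-- Work tapes that can be reset

act : ∀ {Γ : Set} → Γ → Γ × Dir → Tape Γ → Tape Γ
act blank (a , e) t = move blank e (write a t)

-- The content of a cell of a simulating tape: not written since the last reset, a symbol of the
-- simulated machine, or a binary digit. Digits are used on the counter tape only.
data Content (Γ : Set) : Set where
  fresh  : Content Γ
  symbol : Γ → Content Γ
  digit  : Bool → Content Γ

-- The Boolean marks the cell to which the head returns.
Cell : Set → Set
Cell Γ = Content Γ × Bool

emptyCell : ∀ {Γ} → Cell Γ
emptyCell = fresh , false

isFresh : ∀ {Γ} → Cell Γ → Bool
isFresh (fresh , _) = true
isFresh (_     , _) = false

isMarked : ∀ {Γ} → Cell Γ → Bool
isMarked = proj₂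

-- The symbol that the simulated machine sees.
decode : ∀ {Γ} → Γ → Cell Γ → Γ
decode blank (symbol g , _) = g
decode blank _              = blank

overwrite : ∀ {Γ} → Cell Γ → Γ → Cell Γ
overwrite (_ , m) g = symbol g , m

-- What the head does on a cell during a sweep.
leftward erase : ∀ {Γ} → Cell Γ → Cell Γ × Dir
leftward c    = c , left
erase (_ , m) = (fresh , m) , right

-- Repeating f until done holds turns the first tape into the second, in at most n steps.
data Reaches {Γ} (done : Cell Γ → Bool) (f : Cell Γ → Cell Γ × Dir) :
             ℕ → Tape (Cell Γ) → Tape (Cell Γ) → Set where
  arrived : ∀ {n u} → done (Tape.cur u) ≡ true → Reaches done f n u u
  onward  : ∀ {n u v} → done (Tape.cur u) ≡ false →
            Reaches done f n (act emptyCell (f (Tape.cur u)) u) v → Reaches done f (suc n) u v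

-- Positions on a simulating tape are counted so that S is the marked cell and the tape occupies
-- at most 0, …, 2S. A head with h positions to its left and r to its right thus satisfies
-- h + r = 2S, and it is on the marked cell if and only if h = S, equivalently r = S. This makes
-- all invariants symmetric under reflection of the tape.
module Simulated {Γ : Set} (blank : Γ) (S : ℕ) where

  -- The Boolean of a cell that has h positions on one side.
  data Mark (h : ℕ) : Bool → Set where
    origin    : h ≡ S → Mark h true
    elsewhere : h ≢ S → Mark h false

  -- Side h gs xs: the cells xs on one side of a head that has h positions on that side represent
  -- the symbols gs. They are the written cells, nearest first, then visited but unwritten cells.
  -- The condition of end says that the visited cells include the marked one.
  data Side : ℕ → List Γ → List (Cell Γ) → Set where
    end  : ∀ {h} → h ≤ S → Side h [] []
    pad  : ∀ {h m xs} → Mark h m → Side h [] xs → Side (suc h) [] ((fresh , m) ∷ xs)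
    cell : ∀ {h m g gs xs} → Mark h m → Side h gs xs → Side (suc h) (g ∷ gs) ((symbol g , m) ∷ xs)

  data Holds : Content Γ → Γ → Set where
    written   : ∀ {g} → Holds (symbol g) g
    unwritten : Holds fresh blank

  -- Sim t u: the tape u represents t. The inequalities say that the written region, extended by
  -- the cell under the head, contains the marked cell; this is what keeps the head away from the
  -- ends of 0, …, 2S.
  data Sim : Tape Γ → Tape (Cell Γ) → Set where
    sim : ∀ {h r ls g rs xs c m ys} → h + r ≡ S + S → Mark h m →
          Side h ls xs → Side r rs ys → h ≤ S + length ls → r ≤ S + length rs →
          Holds c g → Sim (tape ls g rs) (tape xs (c , m) ys)

  mark-mirror : ∀ {h r m} → h + r ≡ S + S → Mark h m → Mark r m
  mark-mirror {h} {r} eq (origin refl)   = origin (+-cancelˡ-≡ h r h eq)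
  mark-mirror {h} {r} eq (elsewhere h≢S) = elsewhere λ { refl → h≢S (+-cancelʳ-≡ r h r eq) }

  mark-mirror⁻ : ∀ {h r m} → h + r ≡ S + S → Mark r m → Mark h m
  mark-mirror⁻ {h} {r} eq = mark-mirror (trans (+-comm r h) eq)

  side-length : ∀ {h gs xs} → Side h gs xs → length xs ≤ h
  side-length (end _)    = z≤n
  side-length (pad _ s)  = s≤s (side-length s)
  side-length (cell _ s) = s≤s (side-length s)

  sim-cells : ∀ {t u} → Sim t u → cells u ≤ suc (S + S)
  sim-cells {u = tape xs _ ys} (sim {h} {r} eq _ l r′ _ _ _) = begin
    length xs + suc (length ys) ≤⟨ +-mono-≤ (side-length l) (s≤s (side-length r′)) ⟩
    h + suc r                   ≡⟨ +-suc h r ⟩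
    suc (h + r)                 ≡⟨ cong suc eq ⟩
    suc (S + S)                 ∎
    where open ≤-Reasoning

  sim-decode : ∀ {t u} → Sim t u → decode blank (Tape.cur u) ≡ Tape.cur t
  sim-decode (sim _ _ _ _ _ _ written)   = refl
  sim-decode (sim _ _ _ _ _ _ unwritten) = refl

  mirror : ∀ {A} → Tape A → Tape A
  mirror (tape ls a rs) = tape rs a ls

  sim-mirror : ∀ {t u} → Sim t u → Sim (mirror t) (mirror u)
  sim-mirror (sim {h} {r} eq m l r′ l≤ r≤ c) =
    sim (trans (+-comm r h) eq) (mark-mirror eq m) r′ l r≤ l≤ c

  act-mirror : ∀ {A} (b a : A) t → mirror (act b (a , left) (mirror t)) ≡ act b (a , right) t
  act-mirror b a (tape ls _ [])       = refl
  act-mirror b a (tape ls _ (r ∷ rs)) = refl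

  -- A head has room on one side if the written region is short on the other side.
  room : ∀ {h r k} → h + r ≡ S + S → r ≤ S + k → k < S → ∃[ h′ ] h ≡ suc h′
  room {suc h} _ _ _ = h , refl
  room {zero} {k = k} refl r≤ k<S = ⊥-elim (<-irrefl refl (<-≤-trans k<S (+-cancelˡ-≤ S S k r≤)))

  shift : ∀ {r} (k : ℕ) → r ≤ S + k → suc r ≤ S + suc k
  shift {r} k r≤ = subst (suc r ≤_) (sym (+-suc S k)) (s≤s r≤)

  unshift : ∀ {r} (k : ℕ) → suc r ≤ S + suc k → r ≤ S + k
  unshift {r} k r≤ = ≤-pred (subst (suc r ≤_) (+-suc S k) r≤)

  sim-left : ∀ {t u} a → Sim t u → cells t < S →
    Sim (act blank (a , left) t) (act emptyCell (overwrite (Tape.cur u) a , left) u)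
  -- The head visits a new cell; room shows that it lies within 0, …, 2S, and it is not the
  -- marked cell, which has been visited.
  sim-left a (sim {h} {r} {[]} {rs = rs} eq m (end h≤S) r′ l≤ r≤ _) small
    with h′ , refl ← room {h} eq r≤ (<-trans (n<1+n _) small) =
    sim (trans (+-suc h′ r) eq) (elsewhere (<⇒≢ h≤S)) (end (<⇒≤ h≤S))
      (cell (mark-mirror eq m) r′) (m≤n⇒m≤n+o 0 (<⇒≤ h≤S))
      (shift (length rs) r≤) unwritten
  sim-left a (sim {suc h} {r} {[]} {rs = rs} eq m (pad m′ s) r′ l≤ r≤ _) small =
    sim (trans (+-suc h r) eq) m′ s (cell (mark-mirror eq m) r′) (<⇒≤ l≤)
      (shift (length rs) r≤) unwritten
  sim-left a (sim {suc h} {r} {_ ∷ ls} {rs = rs} eq m (cell m′ s) r′ l≤ r≤ _) small =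
    sim (trans (+-suc h r) eq) m′ s (cell (mark-mirror eq m) r′)
      (unshift (length ls) l≤)
      (shift (length rs) r≤) written

  cells-mirror : ∀ {A} (t : Tape A) → cells (mirror t) ≡ cells t
  cells-mirror (tape ls _ rs) = begin
    length rs + suc (length ls) ≡⟨ +-suc (length rs) (length ls) ⟩
    suc (length rs + length ls) ≡⟨ +-comm (suc (length rs)) (length ls) ⟩
    length ls + suc (length rs) ∎
    where open ≡-Reasoning

  cur-mirror : ∀ {A} (t : Tape A) → Tape.cur (mirror t) ≡ Tape.cur t
  cur-mirror (tape _ _ _) = refl

  sim-act : ∀ {t u} a e → Sim t u → cells t < S →
    Sim (act blank (a , e) t) (act emptyCell (overwrite (Tape.cur u) a , e) u)
  sim-act a left  s small = sim-left a s small
  sim-act a stay  (sim eq m l r l≤ r≤ _) small = sim eq m l r l≤ r≤ written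
  sim-act {t} {u} a right s small =
    subst₂ Sim (act-mirror blank a t) (act-mirror emptyCell _ u)
      (subst (λ c → Sim _ (mirror (act emptyCell (overwrite c a , left) (mirror u)))) (cur-mirror u)
        (sim-mirror (sim-left a (sim-mirror s) (subst (_< S) (sym (cells-mirror t)) small))))

  -- The stages of a reset. At first the cells strictly left of the head represent gs, those right
  -- of it rs, and the head is on a written cell.
  data AllWritten : Tape (Cell Γ) → Set where
    allWritten : ∀ {h r gs g rs xs m ys} →
      h + r ≡ S + S → Mark h m → Side h gs xs → Side r rs ys →
      h ≤ S + length gs → r ≤ S + length rs → length gs + length rs < S →
      AllWritten (tape xs (symbol g , m) ys)

  -- The head is on the unwritten cell immediately left of the written region.
  data LeftEnd : Tape (Cell Γ) → Set where
    leftEnd : ∀ {h r g rs xs m ys} →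
      h + r ≡ S + S → Mark h m → Side h [] xs → Side r (g ∷ rs) ys →
      h < S → r ≤ S + suc (length rs) → length rs < S → LeftEnd (tape xs (fresh , m) ys)

  -- Everything left of the head is unwritten, and the cells from the head on represent rs. The
  -- number e counts the cells erased so far.
  data PartlyErased : Tape (Cell Γ) → Set where
    partlyErased : ∀ {h r e rs xs c ys} →
      h + r ≡ S + S → Side h [] xs → Side (suc r) rs (c ∷ ys) →
      r < S + length rs → h ≤ S + e → e + length rs ≤ S → PartlyErased (tape xs c ys)

  -- Every cell is unwritten, and the head is not left of the marked cell.
  data Erased : Tape (Cell Γ) → Set where
    erased : ∀ {h r xs m ys} →
      h + r ≡ S + S → Mark h m → Side h [] xs → Side r [] ys →
      S ≤ h → Erased (tape xs (fresh , m) ys)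

  data AtOrigin : Tape (Cell Γ) → Set where
    atOrigin : ∀ {xs m ys} →
      Mark S m → Side S [] xs → Side S [] ys → AtOrigin (tape xs (fresh , m) ys)

  sim-allWritten : ∀ {t u} → Sim t u → cells t < S →
    AllWritten (act emptyCell (overwrite (Tape.cur u) (decode blank (Tape.cur u)) , stay) u)
  sim-allWritten {tape ls _ rs} (sim eq m l r l≤ r≤ _) small =
    allWritten eq m l r l≤ r≤ (<-trans (+-monoʳ-< (length ls) (n<1+n (length rs))) small)

  atOrigin-sim : ∀ {u} → AtOrigin u → Sim (tape [] blank []) u
  atOrigin-sim (atOrigin m l r) =
    sim refl m l r (m≤m+n S 0) (m≤m+n S 0) unwritten

  -- Sweeps take at most 2S steps, a number common to all tapes of a machine.
  Sweeps : (Cell Γ → Bool) → (Cell Γ → Cell Γ × Dir) →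
           (Tape (Cell Γ) → Set) → (Tape (Cell Γ) → Set) → Set
  Sweeps done f P Q = ∀ {u} → P u → ∃[ v ] Reaches done f (S + S) u v × Q v

  sweep-left : Sweeps isFresh leftward AllWritten LeftEnd
  sweep-left (allWritten {h₀} {r₀} eq₀ m l r l≤ r≤ small) =
    walk (subst (h₀ ≤_) eq₀ (m≤m+n h₀ r₀)) eq₀ m l r l≤ r≤ small
    where
    walk : ∀ {n h r gs g rs xs m ys} → h ≤ n → h + r ≡ S + S → Mark h m →
      Side h gs xs → Side r rs ys → h ≤ S + length gs → r ≤ S + length rs →
      length gs + length rs < S →
      ∃[ v ] Reaches isFresh leftward n (tape xs (symbol g , m) ys) v × LeftEnd v
    walk {h = h} {r} h≤n eq m (end h≤S) s l≤ r≤ small with room {h} eq r≤ small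
    walk {h = suc h} {r} (s≤s h≤n) eq m (end h≤S) s l≤ r≤ small | _ , refl =
      _ , onward refl (arrived refl) ,
      leftEnd (trans (+-suc h r) eq) (elsewhere (<⇒≢ h≤S)) (end (<⇒≤ h≤S))
        (cell (mark-mirror eq m) s) h≤S (shift _ r≤) small
    walk {h = suc h} {r} (s≤s h≤n) eq m (pad m′ l) s l≤ r≤ small =
      _ , onward refl (arrived refl) ,
      leftEnd (trans (+-suc h r) eq) m′ l (cell (mark-mirror eq m) s)
        (subst (suc h ≤_) (+-identityʳ S) l≤) (shift _ r≤) small
    walk {h = suc h} {r} {g ∷ gs} {rs = rs} (s≤s h≤n) eq m (cell m′ l) s l≤ r≤ small
      with v , w , q ← walk h≤n (trans (+-suc h r) eq) m′ l (cell (mark-mirror eq m) s)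
             (unshift _ l≤) (shift _ r≤) (subst (_< S) (sym (+-suc (length gs) (length rs))) small)
      = v , onward refl w , q

  leftEnd-right : ∀ {u} → LeftEnd u → PartlyErased (act emptyCell (Tape.cur u , right) u)
  leftEnd-right (leftEnd {h} {suc r} eq m l (cell m′ s) h<S r≤ small) =
    partlyErased {e = 0} (trans (sym (+-suc h r)) eq) (pad m l) (cell m′ s) r≤
      (m≤n⇒m≤n+o 0 h<S) small

  sweep-erase : Sweeps isFresh erase PartlyErased Erased
  sweep-erase (partlyErased {h₀} {r₀} eq₀ l r r< h≤ small) =
    walk (subst (r₀ ≤_) eq₀ (m≤n+m r₀ h₀)) eq₀ l r r< h≤ small
    where
    walk : ∀ {n h r e rs xs c ys} → r ≤ n → h + r ≡ S + S → Side h [] xs →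
      Side (suc r) rs (c ∷ ys) → r < S + length rs → h ≤ S + e → e + length rs ≤ S →
      ∃[ v ] Reaches isFresh erase n (tape xs c ys) v × Erased v
    walk {h = h} {r} r≤n eq l (pad m s) r< h≤ small =
      _ , arrived refl , erased eq (mark-mirror⁻ eq m) l s
        (<⇒≤ (+-cancelʳ-< r S h
          (subst (S + r <_) (sym eq) (+-monoʳ-< S (subst (r <_) (+-identityʳ S) r<)))))
    -- The last written cell may border on a cell that was never visited.
    walk {h = h} {r} {e} r≤n eq l (cell m (end r≤S)) r< h≤ small
      with room {r} {h} {e} (trans (+-comm r h) eq) h≤ (subst (_≤ S) (+-comm e 1) small)
    walk {h = h} {suc r} {e} (s≤s r≤n) eq l (cell m (end r≤S)) r< h≤ small | _ , refl
      with v , w , q ← walk {e = suc e} r≤n (trans (sym (+-suc h r)) eq)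
             (pad (mark-mirror⁻ eq m) l) (pad (elsewhere (<⇒≢ r≤S)) (end (<⇒≤ r≤S)))
             (unshift 0 r<) (shift e h≤) (subst (_≤ S) (+-suc e 0) small)
      = v , onward refl w , q
    walk {h = h} {suc r} {e} (s≤s r≤n) eq l (cell {gs = gs} m s@(pad _ _)) r< h≤ small
      with v , w , q ← walk {e = suc e} r≤n (trans (sym (+-suc h r)) eq)
             (pad (mark-mirror⁻ eq m) l) s
             (unshift (length gs) r<) (shift e h≤) (subst (_≤ S) (+-suc e (length gs)) small)
      = v , onward refl w , q
    walk {h = h} {suc r} {e} (s≤s r≤n) eq l (cell {gs = gs} m s@(cell _ _)) r< h≤ small
      with v , w , q ← walk {e = suc e} r≤n (trans (sym (+-suc h r)) eq)
             (pad (mark-mirror⁻ eq m) l) s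
             (unshift (length gs) r<) (shift e h≤) (subst (_≤ S) (+-suc e (length gs)) small)
      = v , onward refl w , q

  sweep-seek : Sweeps isMarked leftward Erased AtOrigin
  sweep-seek (erased {h₀} {r₀} eq₀ m l r S≤h) =
    walk (subst (h₀ ≤_) eq₀ (m≤m+n h₀ r₀)) eq₀ m l r S≤h
    where
    walk : ∀ {n h r xs m ys} → h ≤ n → h + r ≡ S + S → Mark h m → Side h [] xs → Side r [] ys →
      S ≤ h → ∃[ v ] Reaches isMarked leftward n (tape xs (fresh , m) ys) v × AtOrigin v
    walk h≤n eq (origin refl) l s S≤h with refl ← +-cancelˡ-≡ S _ S eq =
      _ , arrived refl , atOrigin (origin refl) l s
    walk h≤n eq (elsewhere h≢S) (end h≤S) s S≤h = ⊥-elim (h≢S (≤-antisym h≤S S≤h))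
    walk {h = suc h} {r} (s≤s h≤n) eq m@(elsewhere h≢S) (pad m′ l) s S≤h
      with v , w , q ← walk h≤n (trans (+-suc h r) eq) m′ l
             (pad (mark-mirror eq m) s) (≤-pred (≤∧≢⇒< S≤h (≢-sym h≢S)))
      = v , onward refl w , q

finite-Content : ∀ {Γ} → Finite Γ → Finite (Content Γ)
finite-Content {Γ} finite = finite-↔ iso (finite-⊎ finite-⊤ (finite-⊎ finite finite-Bool))
  where
  iso : Content Γ ↔ (⊤ ⊎ Γ ⊎ Bool)
  iso = mk↔ₛ′
    (λ { fresh → inj₁ tt ; (symbol g) → inj₂ (inj₁ g) ; (digit b) → inj₂ (inj₂ b) })
    (λ { (inj₁ tt) → fresh ; (inj₂ (inj₁ g)) → symbol g ; (inj₂ (inj₂ b)) → digit b })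
    (λ { (inj₁ tt) → refl ; (inj₂ (inj₁ g)) → refl ; (inj₂ (inj₂ b)) → refl })
    (λ { fresh → refl ; (symbol g) → refl ; (digit b) → refl })

-- All tapes perform their writes and moves.
steps : ∀ {Γ : Set} {n} → Γ → Vec (Γ × Dir) n → Vec (Tape Γ) n → Vec (Tape Γ) n
steps blank = Vec.zipWith (act blank)

curs : ∀ {Γ : Set} {n} → Vec (Tape Γ) n → Vec Γ n
curs = Vec.map Tape.cur

keep : ∀ {Γ : Set} {n} → Vec Γ n → Vec (Γ × Dir) n
keep = Vec.map (_, stay)

steps-keep : ∀ {Γ : Set} {n} (b : Γ) (ts : Vec (Tape Γ) n) → steps b (keep (curs ts)) ts ≡ ts
steps-keep b []       = refl
steps-keep b (t ∷ ts) = cong (t ∷_) (steps-keep b ts)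

steps-map : ∀ {Γ : Set} {n} (b : Γ) (f : Γ → Γ × Dir) (ts : Vec (Tape Γ) n) →
  steps b (Vec.map f (curs ts)) ts ≡ Vec.map (λ t → act b (f (Tape.cur t)) t) ts
steps-map b f []       = refl
steps-map b f (t ∷ ts) = cong (_ ∷_) (steps-map b f ts)

-- The functions are compared pointwise, so that f can be the anonymous function inside perform.
zipWith-≗ : ∀ {A B C : Set} {n} {f g : A → B → C} → (∀ a b → f a b ≡ g a b) →
  (as : Vec A n) (bs : Vec B n) → Vec.zipWith f as bs ≡ Vec.zipWith g as bs
zipWith-≗ f≗g []       []       = refl
zipWith-≗ f≗g (a ∷ as) (b ∷ bs) = cong₂ _∷_ (f≗g a b) (zipWith-≗ f≗g as bs)

module _ (H : Hardware) where
  open Hardware H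

  perform-steps : ∀ x q p ts q′ d ws →
    perform x (config q p ts) (action q′ d ws) ≡ config q′ (moveInput x d p) (steps blank ws ts)
  perform-steps x q p ts q′ d ws =
    cong (config q′ (moveInput x d p)) (zipWith-≗ (λ _ _ → refl) ws ts)

every : ∀ {A : Set} {n} → (A → Bool) → Vec A n → Bool
every f []       = true
every f (a ∷ as) = f a ∧ every f as

-- Programs with a counter and a reset instruction

-- Counter operations, with the next control state. A decrement of zero leaves the counter at zero
-- and continues with underflow.
data Op (Ctl : Set) : Set where
  goto inc : Ctl → Op Ctl
  dec      : (success underflow : Ctl) → Op Ctl

-- exec moves the input head, writes and moves on the work tapes, and operates on the counter;
-- reset blanks all work tapes.
data Instr (Ctl Γ : Set) (n : ℕ) : Set where
  exec  : Dir → Vec (Γ × Dir) n → Op Ctl → Instr Ctl Γ n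
  reset : Ctl → Instr Ctl Γ n

-- A nondeterministic program for a machine whose work tapes are supplemented by a counter. It
-- branches into the instructions listed by code; it accepts when there are none and the control
-- state satisfies final.
record Program : Set₁ where
  field
    Ctl       : Set
    finiteCtl : Finite Ctl
    start     : Ctl
    Γ         : Set
    finiteΓ   : Finite Γ
    blank     : Γ
    tapes     : ℕ
    code      : Ctl → InputSymbol → Vec Γ tapes → List (Instr Ctl Γ tapes)
    final     : Ctl → Bool

module Numerals {Γ : Set} where

  -- Num w v cs: the cells cs, least significant digit first, represent v by at most w digits. The
  -- digits may be followed by one empty cell, which a failed decrement has visited.
  data Num : ℕ → ℕ → List (Cell Γ) → Set where
    none : ∀ {w} → Num w 0 []
    edge : ∀ {w} → Num w 0 (emptyCell ∷ [])
    off  : ∀ {w u v cs} → u ≡ v + v → Num w v cs → Num (suc w) u ((digit false , false) ∷ cs)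
    on   : ∀ {w u v cs} → u ≡ suc (v + v) → Num w v cs → Num (suc w) u ((digit true , false) ∷ cs)

  num-length : ∀ {w v cs} → Num w v cs → length cs ≤ suc w
  num-length none      = z≤n
  num-length edge      = s≤s z≤n
  num-length (off _ n) = s≤s (num-length n)
  num-length (on _ n)  = s≤s (num-length n)

  -- The head has just moved right, from the first cell of ls, onto the cells cs.
  enter : List (Cell Γ) → List (Cell Γ) → Tape (Cell Γ)
  enter ls []       = tape ls emptyCell []
  enter ls (c ∷ cs) = tape ls c cs

  act-enter : ∀ ls c a cs → act emptyCell (a , right) (tape ls c cs) ≡ enter (a ∷ ls) cs
  act-enter ls c a []      = refl
  act-enter ls c a (_ ∷ _) = refl

halve-< : ∀ {m n} → m + m < n + n → m < n
halve-< {m} {n} m+m<n+n with n ≤? m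
... | yes n≤m = ⊥-elim (<⇒≱ m+m<n+n (+-mono-≤ n≤m n≤m))
... | no  n≰m = ≰⇒> n≰m

-- The machine that executes a program. Its first work tape is the counter: a marked cell where
-- the head rests, with the digits to its right. The other tapes are reset as described above.
module Compile (P : Program) where
  open Program P

  State : Set
  State = (Fin 8 × Ctl) ⊎ (Ctl × Ctl)

  -- boot marks the resting cells; at q executes the code of q. The states carry and borrow move
  -- right through the digits of the counter, home and undo go back to the marked cell, where undo
  -- reverts a borrow that has found no digit one. The states collect, wipe and seek are the three
  -- sweeps of a reset. The arguments are the control states to continue with.
  pattern boot q      = inj₁ (0F , q)
  pattern at q        = inj₁ (1F , q)
  pattern carry q     = inj₁ (2F , q)
  pattern home q      = inj₁ (3F , q)
  pattern undo q      = inj₁ (4F , q)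
  pattern collect q   = inj₁ (5F , q)
  pattern wipe q      = inj₁ (6F , q)
  pattern seek q      = inj₁ (7F , q)
  pattern borrow q q′ = inj₂ (q , q′)

  machine : Hardware
  machine = record
    { State       = State
    ; finiteState = finite-⊎ (finite-× (finite-Fin 8) finiteCtl) (finite-× finiteCtl finiteCtl)
    ; start       = boot start
    ; Γ           = Cell Γ
    ; finiteΓ     = finite-× (finite-Content finiteΓ) finite-Bool
    ; blank       = emptyCell
    ; tapes       = suc tapes
    }

  open Hardware machine using (Config; config; Action; action; initial; space; perform)

  onCounter : State → Cell Γ × Dir → Vec (Cell Γ) tapes → List Action
  onCounter q c cs = action q stay (c ∷ keep cs) ∷ []

  unless : (done : Cell Γ → Bool) (f : Cell Γ → Cell Γ × Dir) → Cell Γ → Cell Γ × Dir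
  unless done f a = if done a then (a , stay) else f a

  sweepBy : Bool → (done : Cell Γ → Bool) (f exit : Cell Γ → Cell Γ × Dir) (again next : State) →
            Cell Γ → Vec (Cell Γ) tapes → List Action
  sweepBy true  done f exit again next c cs =
    action next stay ((c , stay) ∷ Vec.map exit cs) ∷ []
  sweepBy false done f exit again next c cs =
    action again stay ((c , stay) ∷ Vec.map (unless done f) cs) ∷ []

  -- One step of a sweep of all tapes but the counter. A tape that is done waits for the others; when
  -- all are done, they leave by exit.
  sweep : (done : Cell Γ → Bool) (f exit : Cell Γ → Cell Γ × Dir) (again next : State) →
          Cell Γ → Vec (Cell Γ) tapes → List Action
  sweep done f exit again next c cs = sweepBy (every done cs) done f exit again next c cs

  writeOver : Vec (Cell Γ) tapes → Vec (Γ × Dir) tapes → Vec (Cell Γ × Dir) tapes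
  writeOver = Vec.zipWith (λ { c (g , e) → overwrite c g , e })

  opState : Op Ctl → State
  opState (goto q)   = at q
  opState (inc q)    = carry q
  opState (dec q q′) = borrow q q′

  opDir : Op Ctl → Dir
  opDir (goto _)  = stay
  opDir (inc _)   = right
  opDir (dec _ _) = right

  -- The head of a tape to be reset has to stand on a written cell.
  refresh : Cell Γ → Cell Γ × Dir
  refresh c = overwrite c (decode blank c) , stay

  issue : Cell Γ → Vec (Cell Γ) tapes → Instr Ctl Γ tapes → Action
  issue c cs (exec d ws op) = action (opState op) d ((c , opDir op) ∷ writeOver cs ws)
  issue c cs (reset q)      = action (collect q) stay ((c , stay) ∷ Vec.map refresh cs)

  δ : State → InputSymbol → Vec (Cell Γ) (suc tapes) → List Action
  δ (boot q)   s (c ∷ cs) =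
    action (at q) stay
      (((fresh , true) , stay) ∷ Vec.map (λ _ → (fresh , true) , stay) cs) ∷ []
  δ (at q)     s (c ∷ cs) = map (issue c cs) (code q s (Vec.map (decode blank) cs))
  δ (carry q)  s ((digit true , m) ∷ cs) = onCounter (carry q) ((digit false , m) , right) cs
  δ (carry q)  s ((_          , m) ∷ cs) = onCounter (home q) ((digit true , m) , left) cs
  δ (home q)   s (c@(_ , true)  ∷ cs)    = onCounter (at q) (c , stay) cs
  δ (home q)   s (c@(_ , false) ∷ cs)    = onCounter (home q) (c , left) cs
  δ (borrow q q′) s ((digit true  , m) ∷ cs) = onCounter (home q) ((digit false , m) , left) cs
  δ (borrow q q′) s ((digit false , m) ∷ cs) = onCounter (borrow q q′) ((digit true , m) , right) cs
  δ (borrow q q′) s (c                 ∷ cs) = onCounter (undo q′) (c , left) cs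
  δ (undo q)   s (c@(_ , true)  ∷ cs)    = onCounter (at q) (c , stay) cs
  δ (undo q)   s ((_ , false)   ∷ cs)    = onCounter (undo q) ((digit false , false) , left) cs
  δ (collect q) s (c ∷ cs) = sweep isFresh leftward (_, right) (collect q) (wipe q) c cs
  δ (wipe q)   s (c ∷ cs) = sweep isFresh erase (_, stay) (wipe q) (seek q) c cs
  δ (seek q)   s (c ∷ cs) = sweep isMarked leftward (_, stay) (seek q) (at q) c cs

  accepting : State → Bool
  accepting (at q) = final q
  accepting _      = false

  ntm : NTM
  ntm = record { hardware = machine ; δ = δ ; accepting = accepting }

  open NTM ntm using (successors)
  open Runs ntm
  open Numerals {Γ}

  -- Counter values are below 2^w, simulated tapes have fewer than S cells, and B bounds the space
  -- of the machine: at most w + 2 cells for the counter, and 2S + 1 cells for every other tape.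
  module Semantics (x : Word) (w S B : ℕ)
                   (bound : suc (suc w) + tapes * suc (S + S) ≤ B) where
    open Simulated blank S

    Sims : ∀ {n} → Vec (Tape Γ) n → Vec (Tape (Cell Γ)) n → Set
    Sims = VPointwise Sim

    -- From control state q with input head p, counter k and tapes ts, exactly n paths accept, and the
    -- space stays within B, however the machine represents k and ts.
    record Good (q : Ctl) (p k : ℕ) (ts : Vec (Tape Γ) tapes) (n : ℕ) : Set where
      constructor realised
      field
        run : ∀ {cs us} → Num w k cs → Sims ts us →
              Run x B (config (at q) p (tape [] (fresh , true) cs ∷ us)) n
    open Good

    OpGood : Op Ctl → ℕ → ℕ → Vec (Tape Γ) tapes → ℕ → Set
    OpGood (goto q)   p k       ts n = Good q p k ts n
    OpGood (inc q)    p k       ts n = suc k < 2 ^ w × Good q p (suc k) ts n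
    OpGood (dec q q′) p zero    ts n = Good q′ p zero ts n
    OpGood (dec q q′) p (suc k) ts n = Good q p k ts n

    Small : Vec (Tape Γ) tapes → Set
    Small = All (λ t → cells t < S)

    origins : Vec (Tape Γ) tapes
    origins = Vec.replicate tapes (tape [] blank [])

    -- The instruction, executed with input head p, counter k and tapes ts, leads to n accepting paths.
    InstrGood : ℕ → ℕ → Vec (Tape Γ) tapes → Instr Ctl Γ tapes → ℕ → Set
    InstrGood p k ts (exec d ws op) n = Small ts × OpGood op (moveInput x d p) k (steps blank ws ts) n
    InstrGood p k ts (reset q)      n = Small ts × Good q p k origins n

    advance : ∀ {q p ts q′ d ws n} → accepting q ≡ false →
      δ q (scan x p) (curs ts) ≡ action q′ d ws ∷ [] →
      Run x B (config q′ (moveInput x d p) (steps emptyCell ws ts)) n →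
      Run x B (config q p ts) n
    advance {q} {p} {ts} {q′} {d} {ws} {n} rej eq r =
      run-step rej (cong (map (perform x (config q p ts))) eq)
        (subst (λ c → Run x B c n) (sym (perform-steps machine x q p ts q′ d ws)) r)

    count : ∀ {q p q′ c t us n} → accepting q ≡ false →
      δ q (scan x p) (Tape.cur t ∷ curs us) ≡ onCounter q′ c (curs us) →
      Run x B (config q′ p (act emptyCell c t ∷ us)) n →
      Run x B (config q p (t ∷ us)) n
    count {us = us} {n} rej eq r =
      advance rej eq (subst (λ vs → Run x B (config _ _ (_ ∷ vs)) n) (sym (steps-keep emptyCell us)) r)

    count-right : ∀ {q p q′ ls c a us n} cs → accepting q ≡ false →
      δ q (scan x p) (c ∷ curs us) ≡ onCounter q′ (a , right) (curs us) →
      Run x B (config q′ p (enter (a ∷ ls) cs ∷ us)) n →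
      Run x B (config q p (tape ls c cs ∷ us)) n
    count-right {ls = ls} {c} {a} {us} {n} cs rej eq r =
      count rej eq (subst (λ t → Run x B (config _ _ (t ∷ us)) n) (sym (act-enter ls c a cs)) r)

    -- Procedures on the counter are specified by what has to be shown when they are back on the cell
    -- to the left, which holds l; so the recursion for the following digits is the procedure itself.
    carry-run : ∀ {w k cs} → Num w k cs → suc k < 2 ^ w →
      ∃[ cs′ ] Num w (suc k) cs′ × (∀ {q p l ls us n} →
        Run x B (config (home q) p (tape ls l cs′ ∷ us)) n →
        Run x B (config (carry q) p (enter (l ∷ ls) cs ∷ us)) n)
    carry-run {zero}  none (s≤s ())
    carry-run {suc w} none _ = _ , on {v = 0} refl none , count refl refl
    carry-run {zero}  edge (s≤s ())
    carry-run {suc w} edge _ = _ , on {v = 0} refl none , count refl refl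
    carry-run (off refl num) _ = _ , on refl num , count refl refl
    carry-run {suc w} {cs = _ ∷ cs} (on {v = v} refl num) lt
      with cs′ , num′ , restore ← carry-run num (halve-<
             (subst₂ _<_ (cong suc (sym (+-suc v v))) (cong (2 ^ w +_) (+-identityʳ (2 ^ w))) lt))
      = _ , off (cong suc (sym (+-suc v v))) num′ ,
        λ r → count-right cs refl refl (restore (count refl refl r))

    -- The specification of a decrement; zero is decremented to zero by way of undo.
    Borrows : ℕ → ℕ → List (Cell Γ) → Set
    Borrows w zero cs = ∃[ cs′ ] Num w zero cs′ × (∀ {q q′ p l ls us n} →
      Run x B (config (undo q′) p (tape ls l cs′ ∷ us)) n →
      Run x B (config (borrow q q′) p (enter (l ∷ ls) cs ∷ us)) n)
    Borrows w (suc k) cs = ∃[ cs′ ] Num w k cs′ × (∀ {q q′ p l ls us n} →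
      Run x B (config (home q) p (tape ls l cs′ ∷ us)) n →
      Run x B (config (borrow q q′) p (enter (l ∷ ls) cs ∷ us)) n)

    borrow-run : ∀ {w k cs} → Num w k cs → Borrows w k cs
    borrow-run none = _ , edge , count refl refl
    borrow-run edge = _ , edge , count refl refl
    borrow-run (on refl num) = _ , off refl num , count refl refl
    borrow-run {cs = _ ∷ cs} (off {v = zero} refl num)
      with cs′ , num′ , restore ← borrow-run num
      = _ , off refl num′ ,
        λ r → count-right cs refl refl (restore (count refl refl r))
    borrow-run {cs = _ ∷ cs} (off {v = suc v} refl num)
      with cs′ , num′ , restore ← borrow-run num
      = _ , on (+-suc v v) num′ ,
        λ r → count-right cs refl refl (restore (count refl refl r))

    -- If a sweep succeeds on every single tape, it does so on all of them.
    reaches-all : ∀ {done f Q R n} → Sweeps done f Q R → {us : Vec (Tape (Cell Γ)) n} → All Q us →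
      Σ[ vs ∈ Vec (Tape (Cell Γ)) n ] VPointwise (Reaches done f (S + S)) us vs × All R vs
    reaches-all sw []       = [] , [] , []
    reaches-all {done} {f} {Q} {R} sw (p ∷ ps)
      with v , r , q ← sw p | vs , rs , qs ← reaches-all {done} {f} {Q} {R} sw ps =
      v ∷ vs , r ∷ rs , q ∷ qs

    all-stopped : ∀ {done f n m} {us vs : Vec (Tape (Cell Γ)) n} →
      VPointwise (Reaches done f m) us vs →
      every done (curs us) ≡ true → us ≡ vs
    all-stopped [] _ = refl
    all-stopped {done} {us = u ∷ us} (r ∷ rs) eq with done (Tape.cur u) in d
    all-stopped (arrived _ ∷ rs) eq | true = cong (_ ∷_) (all-stopped rs eq)
    all-stopped (onward e _ ∷ rs) eq | true with () ← trans (sym d) e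

    none-left : ∀ {done f n} {us vs : Vec (Tape (Cell Γ)) n} →
      VPointwise (Reaches done f 0) us vs →
      every done (curs us) ≡ true
    none-left [] = refl
    none-left (arrived e ∷ rs) rewrite e = none-left rs

    all-move : ∀ {done f n m} {us vs : Vec (Tape (Cell Γ)) n} →
      VPointwise (Reaches done f (suc m)) us vs →
      VPointwise (Reaches done f m)
        (Vec.map (λ u → act emptyCell (unless done f (Tape.cur u)) u) us) vs
    all-move [] = []
    all-move (arrived e ∷ rs) rewrite e = arrived e ∷ all-move rs
    all-move (onward e r ∷ rs) rewrite e = r ∷ all-move rs

    sweep-run : ∀ {done f exit again next p c cs us vs n} m →
      accepting again ≡ false →
      (∀ {s} (as : Vec (Cell Γ) tapes) → δ again s (c ∷ as) ≡ sweep done f exit again next c as) →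
      VPointwise (Reaches done f m) us vs →
      Run x B (config next p (tape [] c cs ∷ Vec.map (λ v → act emptyCell (exit (Tape.cur v)) v) vs)) n →
      Run x B (config again p (tape [] c cs ∷ us)) n
    sweep-run {done} {f} {exit} {again} {next} {c = c} {us = us} {n = n} m₀ rej eq rs r
      with every done (curs us) in e | m₀
    ... | true | _ with refl ← all-stopped rs e =
      advance rej (trans (eq (curs us)) (cong (λ b → sweepBy b done f exit again next c (curs us)) e))
        (subst (λ ts → Run x B (config next _ (_ ∷ ts)) n) (sym (steps-map emptyCell exit us)) r)
    ... | false | zero with () ← trans (sym e) (none-left rs)
    ... | false | suc m =
      advance rej (trans (eq (curs us)) (cong (λ b → sweepBy b done f exit again next c (curs us)) e))
        (subst (λ ts → Run x B (config again _ (_ ∷ ts)) n) (sym (steps-map emptyCell (unless done f) us))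
          (sweep-run m rej eq (all-move rs) r))

    sims-allWritten : ∀ {n} {ts : Vec (Tape Γ) n} {us : Vec (Tape (Cell Γ)) n} →
      Sims ts us → All (λ t → cells t < S) ts →
      All AllWritten (Vec.map (λ u → act emptyCell (refresh (Tape.cur u)) u) us)
    sims-allWritten []       []       = []
    sims-allWritten (s ∷ ss) (l ∷ ls) = sim-allWritten s l ∷ sims-allWritten ss ls

    origin-sims : ∀ {n} {us : Vec (Tape (Cell Γ)) n} → All AtOrigin us →
      Sims (Vec.replicate n (tape [] blank [])) us
    origin-sims []       = []
    origin-sims (o ∷ os) = atOrigin-sim o ∷ origin-sims os

    act-stay : ∀ {n} (us : Vec (Tape (Cell Γ)) n) →
      Vec.map (λ u → act emptyCell (Tape.cur u , stay) u) us ≡ us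
    act-stay []       = refl
    act-stay (u ∷ us) = cong (u ∷_) (act-stay us)

    -- The three sweeps of a reset.
    collect-run : ∀ {q p cs us n} → All AllWritten us →
      (∀ {vs} → Sims origins vs → Run x B (config (at q) p (tape [] (fresh , true) cs ∷ vs)) n) →
      Run x B (config (collect q) p (tape [] (fresh , true) cs ∷ us)) n
    collect-run {q} {n = n} as r
      with vs₁ , rs₁ , ls ← reaches-all {isFresh} {leftward} {AllWritten} {LeftEnd} sweep-left as
      with vs₂ , rs₂ , es ← reaches-all {isFresh} {erase} {PartlyErased} {Erased} sweep-erase
             (map⁺ (All.map leftEnd-right ls))
      with vs₃ , rs₃ , os ← reaches-all {isMarked} {leftward} {Erased} {AtOrigin} sweep-seek es
      = sweep-run {next = wipe q} (S + S) refl (λ _ → refl) rs₁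
          (sweep-run {next = seek q} (S + S) refl (λ _ → refl) rs₂
            (subst (λ vs → Run x B (config (seek q) _ (_ ∷ vs)) n) (sym (act-stay vs₂))
              (sweep-run {next = at q} (S + S) refl (λ _ → refl) rs₃
                (subst (λ vs → Run x B (config (at q) _ (_ ∷ vs)) n) (sym (act-stay vs₃))
                  (r (origin-sims os))))))

    sims-cells : ∀ {n} {ts : Vec (Tape Γ) n} {us : Vec (Tape (Cell Γ)) n} → Sims ts us →
      Vec.sum (Vec.map cells us) ≤ n * suc (S + S)
    sims-cells []       = z≤n
    sims-cells (s ∷ ss) = +-mono-≤ (sim-cells s) (sims-cells ss)

    sims-decode : ∀ {n} {ts : Vec (Tape Γ) n} {us : Vec (Tape (Cell Γ)) n} → Sims ts us →
      Vec.map (decode blank) (curs us) ≡ curs ts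
    sims-decode []       = refl
    sims-decode (s ∷ ss) = cong₂ _∷_ (sim-decode s) (sims-decode ss)

    sims-steps : ∀ {n} {ts : Vec (Tape Γ) n} {us} (ws : Vec (Γ × Dir) n) → Sims ts us →
      All (λ t → cells t < S) ts →
      Sims (steps blank ws ts)
        (steps emptyCell (Vec.zipWith (λ { c (g , e) → overwrite c g , e }) (curs us) ws) us)
    sims-steps []             []       []       = []
    sims-steps ((g , e) ∷ ws) (s ∷ ss) (l ∷ ls) = sim-act g e s l ∷ sims-steps ws ss ls

    at-space : ∀ {q p k cs ts us} → Num w k cs → Sims ts us →
      space (config (at q) p (tape [] (fresh , true) cs ∷ us)) ≤ B
    at-space num ss = ≤-trans (+-mono-≤ (s≤s (num-length num)) (sims-cells ss)) bound

    issue-run : ∀ {p k ts cs us n} i → Num w k cs → Sims ts us → InstrGood p k ts i n → ∀ {q} →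
      Run x B (perform x (config q p (tape [] (fresh , true) cs ∷ us))
                         (issue (fresh , true) (curs us) i)) n
    issue-run {p} {cs = cs} {us} {n} (reset q′) num ss (small , good) {q} =
      subst (λ c → Run x B c n)
        (sym (perform-steps machine x q p (tape [] (fresh , true) cs ∷ us) (collect q′) stay
               (((fresh , true) , stay) ∷ Vec.map refresh (curs us))))
        (subst (λ vs → Run x B (config (collect q′) p (tape [] (fresh , true) cs ∷ vs)) n)
          (sym (steps-map emptyCell refresh us))
          (collect-run (sims-allWritten ss small) (run good num)))
    issue-run {p} {k} {ts} {cs} {us} {n} (exec d ws op) num ss (small , good) {q} =
      subst (λ c → Run x B c n)
        (sym (perform-steps machine x q p (tape [] (fresh , true) cs ∷ us) (opState op) d
               (((fresh , true) , opDir op) ∷ writeOver (curs us) ws)))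
        (perform-op op k num good)
      where
      vs : Vec (Tape (Cell Γ)) tapes
      vs = steps emptyCell (writeOver (curs us) ws) us
      perform-op : ∀ op k → Num w k cs → OpGood op (moveInput x d p) k (steps blank ws ts) n →
        Run x B (config (opState op) (moveInput x d p)
                   (act emptyCell ((fresh , true) , opDir op) (tape [] (fresh , true) cs) ∷ vs)) n
      perform-op (goto q) k num good = run good num (sims-steps ws ss small)
      perform-op (inc q) k num (lt , good)
        with cs′ , num′ , restore ← carry-run num lt =
        subst (λ t → Run x B (config _ _ (t ∷ vs)) n) (sym (act-enter [] (fresh , true) (fresh , true) cs))
          (restore (count refl refl (run good num′ (sims-steps ws ss small))))
      perform-op (dec q q′) zero num good
        with cs′ , num′ , restore ← borrow-run num =
        subst (λ t → Run x B (config _ _ (t ∷ vs)) n) (sym (act-enter [] (fresh , true) (fresh , true) cs))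
          (restore (count refl refl (run good num′ (sims-steps ws ss small))))
      perform-op (dec q q′) (suc k) num good
        with cs′ , num′ , restore ← borrow-run num =
        subst (λ t → Run x B (config _ _ (t ∷ vs)) n) (sym (act-enter [] (fresh , true) (fresh , true) cs))
          (restore (count refl refl (run good num′ (sims-steps ws ss small))))

    good-branch : ∀ {q p k ts is ns} → final q ≡ false → code q (scan x p) (curs ts) ≡ is →
      Pointwise (InstrGood p k ts) is ns → Good q p k ts (sum ns)
    good-branch {q} {p} {k} {ts} rej refl goods = realised λ {cs} {us} num ss →
      let c = config (at q) p (tape [] (fresh , true) cs ∷ us) in
      branch rej (λ _ → at-space {q} {p} num ss)
        (subst (λ as → Pointwise (Run x B)
                  (map (perform x c) (map (issue (fresh , true) (curs us)) (code q (scan x p) as))) _)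
          (sym (sims-decode ss)) (runs num ss goods))
      where
      runs : ∀ {cs us is ns} → Num w k cs → Sims ts us → Pointwise (InstrGood p k ts) is ns →
        Pointwise (Run x B) (map (perform x (config (at q) p (tape [] (fresh , true) cs ∷ us)))
          (map (issue (fresh , true) (curs us)) is)) ns
      runs num ss []       = []
      runs {is = i ∷ _} num ss (g ∷ gs) = issue-run i num ss g {at q} ∷ runs num ss gs

    good-step : ∀ {q p k ts i n} → final q ≡ false → code q (scan x p) (curs ts) ≡ i ∷ [] →
      InstrGood p k ts i n → Good q p k ts n
    good-step {q} {p} {k} {ts} {n = n} rej eq good =
      subst (Good q p k ts) (+-identityʳ n) (good-branch rej eq (good ∷ []))

    good-accept : ∀ {q p k ts} → final q ≡ true → (∀ s as → code q s as ≡ []) → Good q p k ts 1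
    good-accept {q} {p} {k} {ts} fin stuck = realised λ {cs} {us} num ss →
      accept (cong (λ is → map (perform x (config (at q) p (tape [] (fresh , true) cs ∷ us)))
                        (map (issue (fresh , true) (curs us)) is))
                (stuck (scan x p) (Vec.map (decode blank) (curs us))))
        (subst T (sym fin) tt) (at-space {q} {p} num ss)

    boot-run : ∀ {n} → Good start 0 0 origins n → Run x B initial n
    boot-run {n} good = advance {d = stay} refl refl
      (subst (λ us → Run x B (config (at start) 0 (tape [] (fresh , true) [] ∷ us)) n)
        (sym (steps-map emptyCell (λ _ → (fresh , true) , stay)
               (Vec.replicate tapes (tape [] emptyCell []))))
        (run good none (origin-sims (boots tapes))))
      where
      boots : ∀ n → All AtOrigin (Vec.map (λ u → act emptyCell ((fresh , true) , stay) u)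
                                     (Vec.replicate n (tape [] emptyCell [])))
      boots zero    = []
      boots (suc n) = atOrigin (origin refl) (end ≤-refl) (end ≤-refl) ∷ boots n

-- Counting the words below an output

-- The flag says whether the guessed word is already below the output (true) or agrees with it so
-- far (false). A step of the transducer that outputs o leads to the listed flags, one for every
-- guess of a bit that does not put the guessed word above the output.
flags : Bool → Maybe Bool → List Bool
flags b     nothing      = b ∷ []
flags true  (just _)     = true ∷ true ∷ []
flags false (just true)  = true ∷ false ∷ []
flags false (just false) = false ∷ []

-- The number of guesses that start with flag b, and are below the output when it ends, if the
-- transducer is still to output w.
weight : Bool → Word → ℕ
weight true  []      = 1
weight false []      = 0
weight b     (o ∷ w) = sum (map (λ b′ → weight b′ w) (flags b (just o)))

weight-foldl : ∀ v w →
  foldl (λ v b → 2 * v + (if b then 1 else 0)) v w ≡ v * weight true w + weight false w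
weight-foldl v []          = solve v
  where
  solve : ∀ v → v ≡ v * 1 + 0
  solve = solve-∀
weight-foldl v (true ∷ w)  =
  trans (weight-foldl (2 * v + 1) w) (solve v (weight true w) (weight false w))
  where
  solve : ∀ v t f → (2 * v + 1) * t + f ≡ v * (t + (t + 0)) + (t + (f + 0))
  solve = solve-∀
weight-foldl v (false ∷ w) =
  trans (weight-foldl (2 * v + 0) w) (solve v (weight true w) (weight false w))
  where
  solve : ∀ v t f → (2 * v + 0) * t + f ≡ v * (t + (t + 0)) + (f + 0)
  solve = solve-∀

weight-binary : ∀ w → weight false w ≡ binary w
weight-binary w = sym (weight-foldl 0 w)

weight-flags : ∀ b o w R →
  sum (map (λ b′ → weight b′ w * R) (flags b o)) ≡ weight b (fromMaybe o ++ w) * R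
weight-flags b     nothing      w R = +-identityʳ _
weight-flags true  (just o)     w R = solve (weight true w) R
  where
  solve : ∀ t r → t * r + (t * r + 0) ≡ (t + (t + 0)) * r
  solve = solve-∀
weight-flags false (just true)  w R = solve (weight true w) (weight false w) R
  where
  solve : ∀ t f r → t * r + (f * r + 0) ≡ (t + (f + 0)) * r
  solve = solve-∀
weight-flags false (just false) w R = solve (weight false w) R
  where
  solve : ∀ f r → f * r + 0 ≡ (f + 0) * r
  solve = solve-∀

-- Words that begin with ones

scan-++ : ∀ a z j → scan (replicate a true ++ z) (a + suc j) ≡ scan z (suc j)
scan-++ zero    z j = refl
scan-++ (suc a) z j with ih ← scan-++ a z j rewrite +-suc a j = ih

scan-ones : ∀ {a p} z → p < a → scan (replicate a true ++ z) (suc p) ≡ bit true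
scan-ones {suc a} {zero}  z _          = refl
scan-ones {suc a} {suc p} z (s≤s p<a) = scan-ones {a} z p<a

on1ⁿ-ones : ∀ F n → on1ⁿ F (replicate n true ++ []) ≡ F n
on1ⁿ-ones F zero    = refl
on1ⁿ-ones F (suc n) = on1ⁿ-ones (F ∘ suc) n

on1ⁿ-false : ∀ F n z → on1ⁿ F (replicate n true ++ false ∷ z) ≡ 0
on1ⁿ-false F zero    z = refl
on1ⁿ-false F (suc n) z = on1ⁿ-false (F ∘ suc) n z

on1ⁿ-replicate : ∀ F n → on1ⁿ F (replicate n true) ≡ F n
on1ⁿ-replicate F zero    = refl
on1ⁿ-replicate F (suc n) = on1ⁿ-replicate (F ∘ suc) n

on1ⁿ01ⁱ-++ : ∀ F a b c →
  on1ⁿ01ⁱ F (replicate a true ++ replicate b true ++ false ∷ replicate c true) ≡ F (a + b) c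
on1ⁿ01ⁱ-++ F zero    zero    c = on1ⁿ-replicate (F 0) c
on1ⁿ01ⁱ-++ F zero    (suc b) c = on1ⁿ01ⁱ-++ (F ∘ suc) zero b c
on1ⁿ01ⁱ-++ F (suc a) b       c = on1ⁿ01ⁱ-++ (F ∘ suc) a b c

-- The minimum of o and N.
clamp : ∀ {N} → ℕ → Fin (suc N)
clamp         zero    = zero
clamp {zero}  (suc o) = zero
clamp {suc N} (suc o) = suc (clamp o)

toℕ-clamp : ∀ {N o} → o ≤ N → toℕ (clamp {N} o) ≡ o
toℕ-clamp {N}     z≤n       = refl
toℕ-clamp {suc N} (s≤s o≤N) = cong suc (toℕ-clamp o≤N)

moveInput-≤ : ∀ u d {h} → h ≤ suc (length u) → moveInput u d h ≤ suc (length u)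
moveInput-≤ u left  h≤ = ≤-trans pred[n]≤n h≤
moveInput-≤ u stay  h≤ = h≤
moveInput-≤ u right h≤ = m⊓n≤n _ _

length-ones-++ : ∀ k u → length (replicate k true ++ u) ≡ k + length u
length-ones-++ k u = trans (length-++ (replicate k true)) (cong (_+ length u) (length-replicate k))

moveInput-++ : ∀ k u d j →
  moveInput (replicate k true ++ u) d (k + suc j) ≡ k + moveInput u d (suc j)
moveInput-++ k u left  j rewrite +-suc k j = refl
moveInput-++ k u stay  j = refl
moveInput-++ k u right j = begin
  suc (k + suc j) ⊓ suc (length (replicate k true ++ u))
    ≡⟨ cong₂ _⊓_ (sym (+-suc k (suc j)))
         (trans (cong suc (length-ones-++ k u)) (sym (+-suc k (length u)))) ⟩
  (k + suc (suc j)) ⊓ (k + suc (length u))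
    ≡⟨ +-distribˡ-⊓ k _ _ ⟨
  k + (suc (suc j) ⊓ suc (length u)) ∎
  where open ≡-Reasoning

sum-applyUpTo : ∀ (f : ℕ → ℕ) n → sum (map (f ∘ toℕ) (allFin n)) ≡ sum (applyUpTo f n)
sum-applyUpTo f n = cong sum (trans (map-tabulate (λ i → i) (f ∘ toℕ)) (go f n))
  where
  go : ∀ (f : ℕ → ℕ) n → tabulate {n = n} (f ∘ toℕ) ≡ applyUpTo f n
  go f zero    = refl
  go f (suc n) = cong (f 0 ∷_) (go (f ∘ suc) n)

-- The program for the recurrence

-- F is the sequence to be counted, and M is a transducer for the coefficients D of its recurrence.
-- The indices of the recurrence are shifted: i : Fin C stands for i + 1.
module Control (C : ℕ) (F : ℕ → ℕ) (M : Transducer) where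
  module M = Transducer M

  -- The word u of the virtual input 1^k u.
  suffix : Fin C → Word
  suffix i = replicate (suc C) true ++ false ∷ replicate (suc (toℕ i)) true

  -- Offset 0 means that the virtual head is where the real input head is; offset j > 0 means that
  -- it is j positions behind 1^k. No suffix is longer than 2C + 2.
  Offset : Set
  Offset = Fin (4 + (C + C))

  Ctl : Set
  Ctl = Fin 2 ⊎ (Fin 3 × Fin (2 + C)) ⊎ (Fin C × Offset × M.State × Bool) ⊎ (Fin C × M.State × Bool)

  -- check verifies that the input has no zeros. In loop r and leaf r, with counter k, the current
  -- number is m = k + (C + 1 - r): the loop decrements k and r until r = 0, where it branches into the
  -- simulations of M, or until the counter underflows, so that m ≤ C and the leaf branches into
  -- F(m) accepting paths. simulate i j q b is the state q of M at offset j with flag b, and cross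
  -- is a move of the real head from inside 1^k to the right. rewind r returns the input head to
  -- position 0, which restores the counter, and enters loop r on blank tapes.
  pattern check            = inj₁ 0F
  pattern accepted         = inj₁ 1F
  pattern rewind r         = inj₂ (inj₁ (0F , r))
  pattern loop r           = inj₂ (inj₁ (1F , r))
  pattern leaf r           = inj₂ (inj₁ (2F , r))
  pattern simulate i j q b = inj₂ (inj₂ (inj₁ (i , j , q , b)))
  pattern cross i q b      = inj₂ (inj₂ (inj₂ (i , q , b)))

  Ins : Set
  Ins = Instr Ctl M.Γ M.tapes

  -- The value of r for m - i, where i is the index of the recurrence counted from 1.
  idx : Fin C → Fin (2 + C)
  idx i = inject₁ (suc i)

  -- The symbol under the virtual head, if s is under the real one.
  symbolAt : Fin C → Offset → InputSymbol → InputSymbol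
  symbolAt i zero    s = s
  symbolAt i (suc j) s = scan (suffix i) (suc (toℕ j))

  -- One move of M. Inside 1^k, the counter is incremented for a move to the left, which has no
  -- effect on the left end marker, and decremented for a move to the right; an underflow shows that
  -- the head stands at position k, so that it enters u.
  follow : Fin C → Offset → InputSymbol → Dir → Vec (M.Γ × Dir) M.tapes → M.State → Bool → Ins
  follow i zero    s stay  ws q b = exec stay ws (goto (simulate i 0F q b))
  follow i zero    ⊢ left  ws q b = exec stay ws (goto (simulate i 0F q b))
  follow i zero    _ left  ws q b = exec left ws (inc (simulate i 0F q b))
  follow i zero    s right ws q b = exec stay ws (dec (cross i q b) (simulate i 1F q b))
  follow i (suc j) s d     ws q b =
    exec stay ws (goto (simulate i (clamp (moveInput (suffix i) d (suc (toℕ j)))) q b))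

  -- If M halts, the guesses below the output survive.
  respond : Fin C → Offset → Bool → InputSymbol → Vec M.Γ M.tapes →
            Maybe (M.Action × Maybe Bool) → List Ins
  respond i j b s as (just (M.action q d ws , o)) = map (follow i j s d ws q) (flags b o)
  respond i j true  s as nothing = exec stay (keep as) (goto (rewind (idx i))) ∷ []
  respond i j false s as nothing = []

  code : Ctl → InputSymbol → Vec M.Γ M.tapes → List Ins
  code check (bit false) as = []
  code check ⊣           as = exec left (keep as) (goto (rewind (fromℕ (suc C)))) ∷ []
  code check _           as = exec right (keep as) (goto check) ∷ []
  code accepted s as = []
  code (rewind r) ⊢ as = reset (loop r) ∷ []
  code (rewind r) _ as = exec left (keep as) (inc (rewind r)) ∷ []
  code (loop zero) s as =
    map (λ i → exec stay (keep as) (goto (simulate i 0F M.start false))) (allFin C)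
  code (loop (suc r)) s as =
    exec stay (keep as) (dec (loop (inject₁ r)) (leaf (suc r))) ∷ []
  code (leaf r) s as = replicate (F (suc C ∸ toℕ r)) (exec stay (keep as) (goto accepted))
  code (simulate i j q b) s as = respond i j b s as (M.δ q (symbolAt i j s) as)
  code (cross i q b) s as = exec right (keep as) (goto (simulate i 0F q b)) ∷ []

  final : Ctl → Bool
  final accepted = true
  final _        = false

  program : Program
  program = record
    { Ctl       = Ctl
    ; finiteCtl = finite-⊎ (finite-Fin 2) (finite-⊎ (finite-× (finite-Fin 3) (finite-Fin (2 + C)))
                    (finite-⊎ (finite-× (finite-Fin C) (finite-× (finite-Fin _) finite-flagged))
                              (finite-× (finite-Fin C) finite-flagged)))
    ; start     = check
    ; Γ         = M.Γ
    ; finiteΓ   = M.finiteΓ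
    ; blank     = M.blank
    ; tapes     = M.tapes
    ; code      = code
    ; final     = final
    }
    where
    finite-flagged : Finite (M.State × Bool)
    finite-flagged = finite-× M.finiteState finite-Bool

  open Compile program

  module Analysis (x : Word) (w S B : ℕ) (bound : suc (suc w) + M.tapes * suc (S + S) ≤ B)
                  (1<S : 1 < S) where
    open Semantics x w S B bound

    small-origins : Small origins
    small-origins = go M.tapes
      where
      go : ∀ n → All (λ t → cells t < S) (Vec.replicate n (tape [] M.blank []))
      go zero    = []
      go (suc n) = 1<S ∷ go n

    good-keep : ∀ {q p k ts n} d op → final q ≡ false →
      code q (scan x p) (curs ts) ≡ exec d (keep (curs ts)) op ∷ [] →
      Small ts → OpGood op (moveInput x d p) k ts n → Good q p k ts n
    good-keep {p = p} {k} {ts} {n} d op rej eq small good =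
      good-step rej eq
        (small , subst (λ us → OpGood op (moveInput x d p) k us n) (sym (steps-keep M.blank ts)) good)

    check-good : (∀ n → x ≡ replicate n true ++ [] → Good (rewind (fromℕ (suc C))) n 0 origins (F n)) →
      Good check 0 0 origins (on1ⁿ F x)
    check-good ones = good-keep right (goto check) refl refl small-origins (go 0 x refl)
      where
      scanned : ∀ n {z} → x ≡ replicate n true ++ z → scan x (suc n) ≡ scan z 1
      scanned n {z} eq = trans (cong₂ scan eq (+-comm 1 n)) (scan-++ n z 0)
      go : ∀ n z → x ≡ replicate n true ++ z → Good check (suc n) 0 origins (on1ⁿ F x)
      go n [] eq =
        good-keep left (goto (rewind (fromℕ (suc C)))) refl
          (cong (λ s → code check s (curs origins)) (scanned n eq)) small-origins
          (subst (Good (rewind (fromℕ (suc C))) n 0 origins)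
            (sym (trans (cong (on1ⁿ F) eq) (on1ⁿ-ones F n))) (ones n eq))
      go n (false ∷ z) eq =
        subst (Good check (suc n) 0 origins) (sym (trans (cong (on1ⁿ F) eq) (on1ⁿ-false F n z)))
          (good-branch refl (cong (λ s → code check s (curs origins)) (scanned n eq)) [])
      go n (true ∷ z) eq =
        good-keep right (goto check) refl
          (cong (λ s → code check s (curs origins)) (scanned n eq)) small-origins
          (subst (λ p → Good check p 0 origins (on1ⁿ F x)) (sym moved) (go (suc n) z eq′))
        where
        snoc : ∀ n → replicate n true ++ true ∷ z ≡ true ∷ replicate n true ++ z
        snoc zero    = refl
        snoc (suc n) = cong (true ∷_) (snoc n)
        eq′ : x ≡ replicate (suc n) true ++ z
        eq′ = trans eq (snoc n)
        moved : moveInput x right (suc n) ≡ suc (suc n)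
        moved = m≤n⇒m⊓n≡m (s≤s (subst (suc n ≤_)
          (sym (trans (cong length eq′) (length-ones-++ (suc n) z))) (m≤m+n (suc n) (length z))))

    module OnOnes (n : ℕ) (x≡ : x ≡ replicate n true ++ []) (n<2^w : n < 2 ^ w) where

      ones : ∀ {p} → p < n → scan x (suc p) ≡ bit true
      ones {p} p<n = trans (cong (λ x → scan x (suc p)) x≡) (scan-ones [] p<n)

      rewind-good : ∀ p {k r ts N} → p + k ≤ n → Small ts →
        Good (loop r) 0 (p + k) origins N → Good (rewind r) p k ts N
      rewind-good zero    _ small good = good-step refl refl (small , good)
      rewind-good (suc p) {k} {r} {ts} {N} p+k≤n small good =
        good-keep left (inc (rewind r)) refl
          (cong (λ s → code (rewind r) s (curs ts)) (ones (≤-trans (s≤s (m≤m+n p k)) p+k≤n))) small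
          ( ≤-<-trans (≤-trans (s≤s (m≤n+m k p)) p+k≤n) n<2^w
          , rewind-good p (subst (_≤ n) (sym (+-suc p k)) p+k≤n) small
              (subst (λ k → Good (loop r) 0 k origins N) (sym (+-suc p k)) good))

      module Simulation (k₀ : ℕ) (k₀≤n : k₀ ≤ n) (i : Fin C) (R : ℕ)
        (small : ∀ {d} → Star (M.Step (replicate k₀ true ++ suffix i)) M.initial d →
                         Small (M.Config.work d))
        (continue : ∀ {p k ts} → p + k ≡ k₀ → Small ts → Good (rewind (idx i)) p k ts R) where

        y : Word
        y = replicate k₀ true ++ suffix i

        -- HeadAt p k j h: real head p, counter k and offset j represent the virtual head h.
        data HeadAt : ℕ → ℕ → Offset → ℕ → Set where
          inside : ∀ {p k} → p + k ≡ k₀ → HeadAt p k zero p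
          beyond : ∀ j → toℕ j ≤ length (suffix i) → HeadAt k₀ 0 (suc j) (k₀ + suc (toℕ j))

        head-total : ∀ {p k j h} → HeadAt p k j h → p + k ≡ k₀
        head-total (inside eq)  = eq
        head-total (beyond _ _) = +-identityʳ k₀

        symbolAt-scan : ∀ {p k j h} → HeadAt p k j h → symbolAt i j (scan x p) ≡ scan y h
        symbolAt-scan {zero}  (inside _)  = refl
        symbolAt-scan {suc p} {k} (inside eq) =
          trans (ones (<-≤-trans p<k₀ k₀≤n)) (sym (scan-ones (suffix i) p<k₀))
          where
          p<k₀ : p < k₀
          p<k₀ = subst (suc p ≤_) eq (m≤m+n (suc p) k)
        symbolAt-scan (beyond j _) = sym (scan-++ k₀ (suffix i) (toℕ j))

        suffix-length : suc (length (suffix i)) ≤ 3 + (C + C)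
        suffix-length = begin
          suc (length (suffix i))
            ≡⟨ cong suc (length-ones-++ (suc C) (false ∷ replicate (suc (toℕ i)) true)) ⟩
          suc (suc C + suc (length (replicate (suc (toℕ i)) true)))
            ≡⟨ cong (λ l → suc (suc C + suc l)) (length-replicate (suc (toℕ i))) ⟩
          2 + (C + (2 + toℕ i))
            ≤⟨ +-monoʳ-≤ (2 + C) (s≤s (toℕ<n i)) ⟩
          2 + (C + suc C)
            ≡⟨ cong (2 +_) (+-suc C C) ⟩
          3 + (C + C) ∎
          where open ≤-Reasoning

        head-offset : ∀ o → o ≤ suc (length (suffix i)) → HeadAt k₀ 0 (clamp o) (k₀ + o)
        head-offset zero    _ =
          subst (HeadAt k₀ 0 zero) (sym (+-identityʳ k₀)) (inside (+-identityʳ k₀))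
        head-offset (suc o) (s≤s o≤) =
          subst (λ o′ → HeadAt k₀ 0 (suc (clamp o)) (k₀ + suc o′)) to
            (beyond (clamp o) (subst (_≤ length (suffix i)) (sym to) o≤))
          where
          to : toℕ (clamp o) ≡ o
          to = toℕ-clamp (≤-trans o≤ (≤-pred suffix-length))

        right-inside : ∀ {p} → p ≤ k₀ → moveInput y right p ≡ suc p
        right-inside p≤ = m≤n⇒m⊓n≡m (s≤s (≤-trans p≤
          (subst (k₀ ≤_) (sym (length-ones-++ k₀ (suffix i))) (m≤m+n k₀ _))))

        length-x : length x ≡ n
        length-x = trans (cong length x≡) (trans (length-ones-++ n []) (+-identityʳ n))

        follow-good : ∀ {p k j h d ws q b ts N} →
          HeadAt p k j h → Small ts → Small (steps M.blank ws ts) →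
          (∀ {p′ k′ j′} → HeadAt p′ k′ j′ (moveInput y d h) →
            Good (simulate i j′ q b) p′ k′ (steps M.blank ws ts) N) →
          InstrGood p k ts (follow i j (scan x p) d ws q b) N
        follow-good {d = stay} (inside eq) s s′ good = s , good (inside eq)
        follow-good {zero} {d = left} (inside eq) s s′ good = s , good (inside eq)
        follow-good {suc p} {k} {d = left} (inside eq) s s′ good
          rewrite ones (<-≤-trans (subst (suc p ≤_) eq (m≤m+n (suc p) k)) k₀≤n) =
          s , ≤-<-trans (≤-trans (subst (suc k ≤_) eq (s≤s (m≤n+m k p))) k₀≤n) n<2^w ,
          good (inside (trans (+-suc p k) eq))
        follow-good {p} {zero} {d = right} (inside eq) s s′ good
          with refl ← trans (sym (+-identityʳ p)) eq =
          s , good (subst (HeadAt k₀ 0 1F) (trans (+-comm k₀ 1) (sym (right-inside ≤-refl))) (beyond 0F z≤n))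
        follow-good {p} {suc k} {d = right} {ws} {q} {b} {ts} {N} (inside eq) s s′ good =
          s , good-keep right _ refl refl s′
            (subst (λ p′ → Good (simulate i 0F q b) p′ k (steps M.blank ws ts) N) (sym moved)
              (good (subst (HeadAt (suc p) k 0F) (sym (right-inside p≤k₀))
                      (inside (trans (sym (+-suc p k)) eq)))))
          where
          p≤k₀ : p ≤ k₀
          p≤k₀ = subst (p ≤_) eq (m≤m+n p (suc k))
          moved : moveInput x right p ≡ suc p
          moved = m≤n⇒m⊓n≡m (s≤s (subst (p ≤_) (sym length-x) (≤-trans p≤k₀ k₀≤n)))
        follow-good {d = d} (beyond j j≤) s s′ good =
          s , good (subst (HeadAt k₀ 0 _) (sym (moveInput-++ k₀ (suffix i) d (toℕ j)))
                (head-offset _ (moveInput-≤ (suffix i) d (s≤s j≤))))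

        next-nothing : ∀ {q h ts} → M.next y (M.config q h ts) ≡ nothing →
          M.δ q (scan y h) (curs ts) ≡ nothing
        next-nothing {q} {h} {ts} eq with M.δ q (scan y h) (curs ts) | eq
        ... | nothing | _ = refl

        next-just : ∀ {q h ts d o} → M.next y (M.config q h ts) ≡ just (d , o) →
          ∃[ a ] M.δ q (scan y h) (curs ts) ≡ just (a , o) × d ≡ M.perform y (M.config q h ts) a
        next-just {q} {h} {ts} eq with M.δ q (scan y h) (curs ts) | eq
        ... | just (a , _) | refl = a , refl , refl

        -- If M is still to output out, and R paths accept from the end of the simulation, then the
        -- number of accepting paths is R times the number of guesses that end below the output.
        simulate-good : ∀ {c out p k j b} → M.Outputs y c out → Star (M.Step y) M.initial c →
          HeadAt p k j (M.Config.head c) →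
          Good (simulate i j (M.Config.state c) b) p k (M.Config.work c) (weight b out * R)
        simulate-good {M.config q h ts} {p = p} {k} {j} {b} (M.halt eq) reach hd = halted b code-eq
          where
          code-eq : ∀ {b} → code (simulate i j q b) (scan x p) (curs ts) ≡
                            respond i j b (scan x p) (curs ts) nothing
          code-eq {b} = cong (respond i j b (scan x p) (curs ts))
            (trans (cong (λ s → M.δ q s (curs ts)) (symbolAt-scan hd)) (next-nothing eq))
          halted : ∀ b → code (simulate i j q b) (scan x p) (curs ts) ≡
                         respond i j b (scan x p) (curs ts) nothing →
            Good (simulate i j q b) p k ts (weight b [] * R)
          halted false eq′ = good-branch refl eq′ []
          halted true  eq′ = subst (Good _ p k ts) (sym (+-identityʳ R))
            (good-keep stay _ refl eq′ (small reach) (continue (head-total hd) (small reach)))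
        simulate-good {M.config q h ts} {p = p} {k} {j} {b} (M.step {d} {o} {out} eq outs) reach hd
          with M.action q′ e ws , δ≡ , d≡ ← next-just eq =
          subst (Good (simulate i j q b) p k ts) (weight-flags b o out R)
            (good-branch refl
              (cong (respond i j b (scan x p) (curs ts))
                (trans (cong (λ s → M.δ q s (curs ts)) (symbolAt-scan hd)) δ≡))
              (branches (flags b o)))
          where
          reach′ : Star (M.Step y) M.initial d
          reach′ = reach ◅◅ ((o , eq) ◅ ε)
          d≡′ : d ≡ M.config q′ (moveInput y e h) (steps M.blank ws ts)
          d≡′ = trans d≡ (perform-steps M.hardware y q h ts q′ e ws)
          branches : ∀ bs → Pointwise (InstrGood p k ts) (map (follow i j (scan x p) e ws q′) bs)
                                      (map (λ b′ → weight b′ out * R) bs)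
          branches []        = []
          branches (b′ ∷ bs) =
            follow-good hd (small reach) (subst (Small ∘ M.Config.work) d≡′ (small reach′))
              (λ {p′} {k′} {j′} hd′ →
                subst (λ c → Good (simulate i j′ (M.Config.state c) b′) p′ k′ (M.Config.work c)
                               (weight b′ out * R)) d≡′
                 (simulate-good outs reach′ (subst (HeadAt p′ k′ j′ ∘ M.Config.head) (sym d≡′) hd′)))
            ∷ branches bs

      module Recurrence
        (output : ℕ → Fin C → Word)
        (outputs : ∀ k i → k + suc C ≤ n →
          M.Outputs (replicate k true ++ suffix i) M.initial (output k i))
        (small : ∀ {k i d} → k + suc C ≤ n →
          Star (M.Step (replicate k true ++ suffix i)) M.initial d → Small (M.Config.work d))
        (recurrence : ∀ k → k + suc C ≤ n →
          sum (map (λ i → binary (output k i) * F (k + (C ∸ toℕ i))) (allFin C)) ≡ F (k + suc C))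
        where

        -- The current number m of loop r with counter k.
        value : ℕ → Fin (2 + C) → ℕ
        value k r = k + (suc C ∸ toℕ r)

        value-dec : ∀ k r → value (suc k) (suc r) ≡ value k (inject₁ r)
        value-dec k r = begin
          suc k + (C ∸ toℕ r)            ≡⟨ +-suc k _ ⟨
          k + suc (C ∸ toℕ r)            ≡⟨ cong (k +_) (+-∸-assoc 1 (toℕ≤pred[n] r)) ⟨
          k + (suc C ∸ toℕ r)            ≡⟨ cong (λ e → k + (suc C ∸ e)) (toℕ-inject₁ r) ⟨
          k + (suc C ∸ toℕ (inject₁ r))  ∎
          where open ≡-Reasoning

        value-idx : ∀ k i → value k (idx i) ≡ k + (C ∸ toℕ i)
        value-idx k i = cong (λ e → k + (suc C ∸ e)) (toℕ-inject₁ (suc i))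

        leaf-good : ∀ r {k} → Good (leaf r) 0 k origins (F (suc C ∸ toℕ r))
        leaf-good r {k} = subst (Good (leaf r) 0 k origins) (sum-ones _) (good-branch refl refl (accepts _))
          where
          sum-ones : ∀ v → sum (replicate v 1) ≡ v
          sum-ones zero    = refl
          sum-ones (suc v) = cong suc (sum-ones v)
          accepts : ∀ v → Pointwise (InstrGood 0 k origins)
            (replicate v (exec stay (keep (curs origins)) (goto accepted))) (replicate v 1)
          accepts zero    = []
          accepts (suc v) =
            (small-origins , subst (λ ts → Good accepted 0 k ts 1) (sym (steps-keep M.blank origins))
                               (good-accept refl (λ _ _ → refl))) ∷ accepts v

        -- Induction on m, and for given m on r, which s keeps structurally decreasing.
        loop-good : ∀ {m} → Acc _<_ m → m ≤ n → ∀ s k r → toℕ r ≡ s → value k r ≡ m →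
          Good (loop r) 0 k origins (F m)
        loop-good (acc rec) m≤n _ k zero _ refl =
          subst (Good (loop zero) 0 k origins) (recurrence k m≤n) (good-branch refl refl (branches (allFin C)))
          where
          subtree : ∀ i → Good (simulate i 0F M.start false) 0 k origins
                            (binary (output k i) * F (k + (C ∸ toℕ i)))
          subtree i =
            subst (λ v → Good (simulate i 0F M.start false) 0 k origins (v * F (k + (C ∸ toℕ i))))
              (weight-binary (output k i))
              (simulate-good (outputs k i m≤n) ε (inside refl))
            where
            continue : ∀ {p l ts} → p + l ≡ k → Small ts → Good (rewind (idx i)) p l ts (F (k + (C ∸ toℕ i)))
            continue {p} {l} eq small = rewind-good p (≤-trans (≤-reflexive eq) k≤n) small
              (subst (λ k′ → Good (loop (idx i)) 0 k′ origins (F (k + (C ∸ toℕ i)))) (sym eq)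
                (loop-good (rec smaller) (≤-trans (<⇒≤ smaller) m≤n) _ k (idx i) refl (value-idx k i)))
              where
              smaller : k + (C ∸ toℕ i) < k + suc C
              smaller = +-monoʳ-< k (s≤s (m∸n≤m C (toℕ i)))
              k≤n : k ≤ n
              k≤n = ≤-trans (m≤m+n k (suc C)) m≤n
            open Simulation k (≤-trans (m≤m+n k (suc C)) m≤n) i (F (k + (C ∸ toℕ i))) (small m≤n) continue
          branches : ∀ is → Pointwise (InstrGood 0 k origins)
            (map (λ i → exec stay (keep (curs origins)) (goto (simulate i 0F M.start false))) is)
            (map (λ i → binary (output k i) * F (k + (C ∸ toℕ i))) is)
          branches []       = []
          branches (i ∷ is) = (small-origins , subst (λ ts → Good (simulate i 0F M.start false) 0 k ts _)
            (sym (steps-keep M.blank origins)) (subtree i)) ∷ branches is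
        loop-good _ _ _ zero (suc r) _ refl =
          good-keep stay _ refl refl small-origins (leaf-good (suc r))
        loop-good a m≤n (suc s) (suc k) (suc r) eq v =
          good-keep stay _ refl refl small-origins
            (loop-good a m≤n s k (inject₁ r) (trans (toℕ-inject₁ r) (suc-injective eq))
              (trans (sym (value-dec k r)) v))

        start-good : Good (rewind (fromℕ (suc C))) n 0 origins (F n)
        start-good = rewind-good n (≤-reflexive (+-identityʳ n)) small-origins
          (loop-good (<-wellFounded n) ≤-refl _ (n + 0) (fromℕ (suc C)) refl
            (trans (cong₂ (λ l e → l + (suc C ∸ e)) (+-identityʳ n) (toℕ-fromℕ (suc C)))
              (trans (cong (n +_) (n∸n≡0 (suc C))) (+-identityʳ n))))

-- Space bounds

log-suc : ∀ n → ⌊log₂ suc n ⌋ ≤ suc ⌊log₂ n ⌋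
log-suc zero    = z≤n
log-suc (suc n) = begin
  ⌊log₂ suc (suc n) ⌋ ≤⟨ ⌊log₂⌋-mono-≤ 2+n≤2*[1+n] ⟩
  ⌊log₂ 2 * suc n ⌋   ≡⟨ ⌊log₂[2*b]⌋≡1+⌊log₂b⌋ (suc n) ⟩
  suc ⌊log₂ suc n ⌋   ∎
  where
  open ≤-Reasoning
  2+n≤2*[1+n] : suc (suc n) ≤ 2 * suc n
  2+n≤2*[1+n] = subst (_≤ 2 * suc n) (+-comm (suc n) 1) (+-monoʳ-≤ (suc n) (s≤s z≤n))

log-+ : ∀ d n → ⌊log₂ d + n ⌋ ≤ d + ⌊log₂ n ⌋
log-+ zero    n = ≤-refl
log-+ (suc d) n = ≤-trans (log-suc (d + n)) (s≤s (log-+ d n))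

n<2^[1+log₂n] : ∀ n → n < 2 ^ suc ⌊log₂ n ⌋
n<2^[1+log₂n] n = ≰⇒> λ 2^≤n →
  1+n≰n (subst (_≤ ⌊log₂ n ⌋) (⌊log₂[2^n]⌋≡n (suc ⌊log₂ n ⌋)) (⌊log₂⌋-mono-≤ 2^≤n))

cells-All : ∀ {Γ : Set} {n S} (ts : Vec (Tape Γ) n) →
  Vec.sum (Vec.map cells ts) < S → All (λ t → cells t < S) ts
cells-All []       _ = []
cells-All (t ∷ ts) s =
  ≤-<-trans (m≤m+n (cells t) _) s ∷ cells-All ts (≤-<-trans (m≤n+m _ (cells t)) s)

when-true : ∀ {P : Set} {v} (P? : Dec P) → P → v when P? ≡ v
when-true (yes _) _ = refl
when-true (no ¬p) p = ⊥-elim (¬p p)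

theorem3p7 : (C : ℕ) → 1 ≤ C →
    (A : ℕ → ℕ) (D : ℕ → ℕ → ℕ) →
    (∀ n → C < n → A n ≡ ∑₁ C (λ i → D n i * A (n ∸ i))) →
    (∃₂ λ a k → ∀ n i → C < n → 1 ≤ i → i ≤ C → D n i ≤ a * n ^ k) →
    FL≥0 (on1ⁿ01ⁱ (λ n i → D n i when (C <? n ×-dec 1 ≤? i ×-dec i ≤? C))) →
    #L (on1ⁿ (λ n → A n when (1 ≤? n)))
theorem3p7 C _ A D recurrence _ (M , (cM , logspace) , computes) =
  Runs.#L-by-runs (Compile.ntm program) c λ x → runs x
  where
  F : ℕ → ℕ
  F n = A n when (1 ≤? n)

  open Control C F M

  G : ℕ → ℕ → ℕ
  G n i = D n i when (C <? n ×-dec 1 ≤? i ×-dec i ≤? C)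

  -- With ℓ = 1 + log |x|, a virtual input has length at most C + 1 + |x| and logarithm at most
  -- C + ℓ; so M has space at most cM (2 + C) ℓ, less than sℓ. The counter has ℓ digits, and cℓ
  -- bounds the space of the whole machine.
  s c : ℕ
  s = 2 + cM * (2 + C)
  c = 3 + M.tapes * (1 + (s + s))

  module OnInput (x : Word) where
    ℓ : ℕ
    ℓ = suc ⌊log₂ length x ⌋

    bound : suc (suc ℓ) + M.tapes * suc (s * ℓ + s * ℓ) ≤ c * ℓ
    bound = begin
      2 + ℓ + M.tapes * suc (s * ℓ + s * ℓ)
        ≤⟨ +-mono-≤ 2+ℓ≤3ℓ (*-monoʳ-≤ M.tapes (+-monoˡ-≤ (s * ℓ + s * ℓ) (s≤s z≤n))) ⟩
      3 * ℓ + M.tapes * (ℓ + (s * ℓ + s * ℓ))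
        ≡⟨ regroup ℓ M.tapes s ⟩
      c * ℓ ∎
      where
      open ≤-Reasoning
      2+ℓ≤3ℓ : 2 + ℓ ≤ 3 * ℓ
      2+ℓ≤3ℓ = subst (_≤ 3 * ℓ) (+-comm ℓ 2)
        (+-monoʳ-≤ ℓ (+-mono-≤ {1} (s≤s z≤n) (+-mono-≤ {1} {ℓ} {0} (s≤s z≤n) z≤n)))
      regroup : ∀ l t s → 3 * l + t * (l + (s * l + s * l)) ≡ (3 + t * (1 + (s + s))) * l
      regroup = solve-∀

    1<S : 1 < s * ℓ
    1<S = *-mono-≤ {2} {s} {1} {ℓ} (s≤s (s≤s z≤n)) (s≤s z≤n)

    open Analysis x ℓ (s * ℓ) (c * ℓ) bound 1<S

    virtual-length : ∀ {k} i → k + suc C ≤ length x →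
      length (replicate k true ++ suffix i) ≤ suc C + length x
    virtual-length {k} i k≤ = begin
      length (replicate k true ++ suffix i)
        ≡⟨ trans (length-ones-++ k (suffix i)) (cong (k +_) (length-ones-++ (suc C) _)) ⟩
      k + (suc C + suc (length (replicate (suc (toℕ i)) true)))
        ≡⟨ +-assoc k (suc C) _ ⟨
      (k + suc C) + suc (length (replicate (suc (toℕ i)) true))
        ≡⟨ cong (λ l → (k + suc C) + suc l) (length-replicate (suc (toℕ i))) ⟩
      (k + suc C) + suc (suc (toℕ i))
        ≤⟨ +-mono-≤ k≤ (s≤s (toℕ<n i)) ⟩
      length x + suc C
        ≡⟨ +-comm (length x) (suc C) ⟩
      suc C + length x ∎
      where open ≤-Reasoning

    virtual-space : ∀ {k} i → k + suc C ≤ length x →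
      cM * (1 + ⌊log₂ length (replicate k true ++ suffix i) ⌋) < s * ℓ
    virtual-space {k} i k≤ = begin-strict
      cM * (1 + ⌊log₂ length (replicate k true ++ suffix i) ⌋)
        ≤⟨ *-monoʳ-≤ cM (s≤s (≤-trans (⌊log₂⌋-mono-≤ (virtual-length i k≤)) (log-+ (suc C) (length x)))) ⟩
      cM * (1 + (suc C + ⌊log₂ length x ⌋))
        ≡⟨ cong (cM *_) (+-suc (suc C) ⌊log₂ length x ⌋) ⟨
      cM * (suc C + ℓ)
        ≤⟨ *-monoʳ-≤ cM (+-monoˡ-≤ ℓ
             (subst (_≤ suc C * ℓ) (*-identityʳ (suc C)) (*-monoʳ-≤ (suc C) (s≤s z≤n)))) ⟩
      cM * (suc C * ℓ + ℓ)
        <⟨ m<n+m _ {2 * ℓ} (s≤s z≤n) ⟩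
      2 * ℓ + cM * (suc C * ℓ + ℓ)
        ≡⟨ regroup cM C ℓ ⟩
      s * ℓ ∎
      where
      open ≤-Reasoning
      regroup : ∀ m C l → 2 * l + m * (suc C * l + l) ≡ (2 + m * (2 + C)) * l
      regroup = solve-∀

    module Accepted (n : ℕ) (x≡ : x ≡ replicate n true ++ []) where
      length-x : length x ≡ n
      length-x = trans (cong length x≡) (trans (length-ones-++ n []) (+-identityʳ n))

      word : ℕ → Fin C → Word
      word k i = proj₁ (computes (replicate k true ++ suffix i))

      word-binary : ∀ k i → binary (word k i) ≡ D (k + suc C) (suc (toℕ i))
      word-binary k i = begin
        binary (word k i)
          ≡⟨ proj₂ (proj₂ (computes (replicate k true ++ suffix i))) ⟩
        on1ⁿ01ⁱ G (replicate k true ++ suffix i)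
          ≡⟨ on1ⁿ01ⁱ-++ G k (suc C) (suc (toℕ i)) ⟩
        G (k + suc C) (suc (toℕ i))
          ≡⟨ when-true (C <? k + suc C ×-dec 1 ≤? suc (toℕ i) ×-dec suc (toℕ i) ≤? C)
               (m≤n+m (suc C) k , s≤s z≤n , toℕ<n i) ⟩
        D (k + suc C) (suc (toℕ i)) ∎
        where open ≡-Reasoning

      rest : ∀ k i → F (k + (C ∸ toℕ i)) ≡ A (k + suc C ∸ suc (toℕ i))
      rest k i = begin
        F (k + (C ∸ toℕ i))
          ≡⟨ when-true (1 ≤? k + (C ∸ toℕ i)) (≤-trans (m<n⇒0<n∸m (toℕ<n i)) (m≤n+m _ k)) ⟩
        A (k + (C ∸ toℕ i))
          ≡⟨ cong A (+-∸-assoc k (<⇒≤ (s≤s (toℕ<n i)))) ⟨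
        A (k + suc C ∸ suc (toℕ i)) ∎
        where open ≡-Reasoning

      sums : ∀ k → sum (map (λ i → binary (word k i) * F (k + (C ∸ toℕ i))) (allFin C)) ≡ F (k + suc C)
      sums k = begin
        sum (map (λ i → binary (word k i) * F (k + (C ∸ toℕ i))) (allFin C))
          ≡⟨ cong sum (map-cong (λ i → cong₂ _*_ (word-binary k i) (rest k i)) (allFin C)) ⟩
        sum (map (λ i → D (k + suc C) (suc (toℕ i)) * A (k + suc C ∸ suc (toℕ i))) (allFin C))
          ≡⟨ sum-applyUpTo (λ i → D (k + suc C) (suc i) * A (k + suc C ∸ suc i)) C ⟩
        ∑₁ C (λ i → D (k + suc C) i * A (k + suc C ∸ i))
          ≡⟨ recurrence (k + suc C) (m≤n+m (suc C) k) ⟨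
        A (k + suc C)
          ≡⟨ when-true (1 ≤? k + suc C) (≤-trans (s≤s z≤n) (m≤n+m (suc C) k)) ⟨
        F (k + suc C) ∎
        where open ≡-Reasoning

      open OnOnes n x≡ (subst (λ m → m < 2 ^ ℓ) length-x (n<2^[1+log₂n] (length x)))
      open Recurrence word (λ k i _ → proj₁ (proj₂ (computes (replicate k true ++ suffix i))))
        (λ {k} {i} k≤ reach → cells-All _ (≤-<-trans (logspace _ _ reach)
          (virtual-space i (subst (k + suc C ≤_) (sym length-x) k≤))))
        (λ k _ → sums k) public using (start-good)

    result : Runs.Run (Compile.ntm program) x (c * ℓ) _ (on1ⁿ F x)
    result = Compile.Semantics.boot-run program x ℓ (s * ℓ) (c * ℓ) bound
      (check-good λ n x≡ → Accepted.start-good n x≡)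

  runs : ∀ x → Runs.Run (Compile.ntm program) x (c * (1 + ⌊log₂ length x ⌋))
                 (NTM.initial (Compile.ntm program)) (on1ⁿ F x)
  runs x = OnInput.result x
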